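{- If $\alpha$ is of the form $\sigma_{\beta}$ for some ordinal $\beta$, then there are no $\alpha$-wITRM-recognizable constructible subsets of $\alpha$ (and thus, in particular, no constructible subset of $\alpha$ that is $\alpha$-wITRM-recognizable but not $\alpha$-wITRM-computable, i.e., no lost melodies for $\alpha$-wITRMs).
   Context: For an ordinal $\beta$, $\sigma_{\beta}$ is the smallest ordinal $\gamma>\beta$ such that $L_{\gamma}\prec_{\Sigma_{1}}L$. Machines. An $\alpha$-register machine program is an ordinary register machine program: a finite list of numbered lines using finitely many registers, each register containing an ordinal $<\alpha$. Commands: increment a register by $1$; copy one register to another; jump to a given line if two register contents agree (otherwise go to the next line); oracle command: for an oracle $x\subseteq\alpha$, replace the content $\iota$ of register $j$ by $1$ if $\iota\in x$ and by $0$ otherwise. Computations run along the ordinals: at successor times the active command is carried out; at limit times the index of the active program line and each register content are the inferior limits of the sequences of their earlier values. If such an inferior limit of register contents equals $\alpha$ (overflow), the computation of an $\alpha$-wITRM is undefined. Inputs and parameters are written in the first registers, all other registers start with $0$. $P^{x}(\vec\xi)\downarrow=c$ means that $P$ with oracle $x$ and input $\vec\xi$ halts with $c$ in the output register. A set $x\subseteq\alpha$ is $\alpha$-wITRM-computable if there are an $\alpha$-wITRM-program $P$ and a parameter $\rho<\alpha$ such that $P(\iota,\rho)\downarrow=\chi_{x}(\iota)$ for all $\iota<\alpha$. It is $\alpha$-wITRM-recognizable if there are an $\alpha$-wITRM-program $P$ and a parameter $\xi<\alpha$ such that, for all $y\subseteq\alpha$, $P^{y}(\xi)$ is defined and halts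 with output $1$ if $y=x$ and with output $0$ if $y\neq x$. Only constructible subsets of $\alpha$ are considered. -}

module Defs where

open import Level using (Level; Lift)
open import Data.Empty using (⊥; ⊥-elim)
open import Data.Fin.Base using (Fin; zero; suc; fromℕ<)
open import Data.List.Base using (List; length; lookup)
open import Data.Maybe.Base using (Maybe; maybe′)
open import Data.Nat.Base as ℕ using (ℕ)
open import Data.Product.Base using (Σ; Σ-syntax; ∃-syntax; _×_; _,_; proj₁; proj₂)
open import Data.Sum.Base using (_⊎_)
open import Data.Vec.Functional using (Vector; []; _∷_; _++_; replicate; updateAt)
open import Function.Base using (const)
open import Function.Bundles using (_⇔_)
open import Relation.Binary.PropositionalEquality.Core using (_≡_)
open import Relation.Nullary.Negation.Core using (¬_)

infix 4 _≈_ _∈_ _∉_ _⊆_ _≋_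

------------------------------------------------------------------------
-- Sets

-- Aczel's cumulative hierarchy: sup A f is the set { f a | a : A }.
-- Equality of sets is the extensional equality _≈_.  Under excluded
-- middle this is a model of ZF.

data V : Set₁ where
  sup : (A : Set) → (A → V) → V

Index : V → Set
Index (sup A f) = A

el : (x : V) → Index x → V
el (sup A f) = f

_≈_ : V → V → Set
sup A f ≈ sup B g = (∀ a → ∃[ b ] f a ≈ g b) × (∀ b → ∃[ a ] f a ≈ g b)

≈-refl : ∀ x → x ≈ x
≈-refl (sup A f) = (λ a → a , ≈-refl (f a)) , (λ a → a , ≈-refl (f a))

_∈_ _∉_ _⊆_ : V → V → Set
x ∈ y = ∃[ j ] x ≈ el y j
x ∉ y = ¬ x ∈ y
x ⊆ y = ∀ i → el x i ∈ y

∅ : V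
∅ = sup ⊥ ⊥-elim

-- x ∪ {x}
succ : V → V
succ x = sup (Maybe (Index x)) (maybe′ (el x) x)

one : V
one = succ ∅

fromℕ : ℕ → V
fromℕ ℕ.zero    = ∅
fromℕ (ℕ.suc n) = succ (fromℕ n)

separate : (x : V) → (Index x → Set) → V
separate x Q = sup (Σ (Index x) Q) (λ p → el x (proj₁ p))

------------------------------------------------------------------------
-- Von Neumann ordinals: the order is _∈_, and its reflexive closure is _⊆_

Transitive : V → Set
Transitive x = ∀ i → el x i ⊆ x

Ordinal : V → Set
Ordinal x = Transitive x × (∀ i → Transitive (el x i))

Limit : V → Set
Limit t = Index t × (∀ i → succ (el t i) ∈ t)

-- The inferior limit  sup_{s<t} inf_{s≤r<t} u(r)  of ordinals u(r):
-- suprema are unions and infima are intersections, and the element z of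
-- u(s) lies in the intersection when z ∈ u(r) for all r with s ≤ r < t.
liminf : (t : V) → (V → V) → V
liminf t u = sup
  (Σ[ s ∈ Index t ] Σ[ z ∈ Index (u (el t s)) ]
     (∀ r → el t s ⊆ el t r → el (u (el t s)) z ∈ u (el t r)))
  (λ (s , z , _) → el (u (el t s)) z)

------------------------------------------------------------------------
-- The language of set theory

infix  6 _∈̇_ _≐_
infixr 5 _∧̇_
infixr 4 _∨̇_
infixr 3 _⇒̇_

-- Formulas with free variables in Fin n (de Bruijn indices)
data Formula : ℕ → Set where
  _∈̇_ _≐_         : ∀ {n} → Fin n → Fin n → Formula n
  ¬̇_              : ∀ {n} → Formula n → Formula n
  _∧̇_ _∨̇_ _⇒̇_     : ∀ {n} → Formula n → Formula n → Formula n
  ∀̇_ ∃̇_           : ∀ {n} → Formula (ℕ.suc n) → Formula n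

data Δ₀ : ∀ {n} → Formula n → Set where
  mem  : ∀ {n} {i j : Fin n} → Δ₀ (i ∈̇ j)
  eq   : ∀ {n} {i j : Fin n} → Δ₀ (i ≐ j)
  neg  : ∀ {n} {φ : Formula n} → Δ₀ φ → Δ₀ (¬̇ φ)
  conj : ∀ {n} {φ ψ : Formula n} → Δ₀ φ → Δ₀ ψ → Δ₀ (φ ∧̇ ψ)
  disj : ∀ {n} {φ ψ : Formula n} → Δ₀ φ → Δ₀ ψ → Δ₀ (φ ∨̇ ψ)
  impl : ∀ {n} {φ ψ : Formula n} → Δ₀ φ → Δ₀ ψ → Δ₀ (φ ⇒̇ ψ)
  all∈ : ∀ {n} {i : Fin n} {φ : Formula (ℕ.suc n)} →
         Δ₀ φ → Δ₀ (∀̇ (zero ∈̇ suc i ⇒̇ φ))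
  ex∈  : ∀ {n} {i : Fin n} {φ : Formula (ℕ.suc n)} →
         Δ₀ φ → Δ₀ (∃̇ (zero ∈̇ suc i ∧̇ φ))

data Σ₁ : ∀ {n} → Formula n → Set where
  bounded : ∀ {n} {φ : Formula n} → Δ₀ φ → Σ₁ φ
  ex      : ∀ {n} {φ : Formula (ℕ.suc n)} → Σ₁ φ → Σ₁ (∃̇ φ)

-- Truth in the ∈-structure with domain D, whose elements denote sets
-- via ⟦_⟧.  The domain may be a set (D = Index x) or a proper class.
module _ {ℓ : Level} {D : Set ℓ} (⟦_⟧ : D → V) where

  Sat : ∀ {n} → Formula n → Vector D n → Set ℓ
  Sat (i ∈̇ j) ρ = Lift ℓ (⟦ ρ i ⟧ ∈ ⟦ ρ j ⟧)
  Sat (i ≐ j) ρ = Lift ℓ (⟦ ρ i ⟧ ≈ ⟦ ρ j ⟧)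
  Sat (¬̇ φ)   ρ = ¬ Sat φ ρ
  Sat (φ ∧̇ ψ) ρ = Sat φ ρ × Sat ψ ρ
  Sat (φ ∨̇ ψ) ρ = Sat φ ρ ⊎ Sat ψ ρ
  Sat (φ ⇒̇ ψ) ρ = Sat φ ρ → Sat ψ ρ
  Sat (∀̇ φ)   ρ = ∀ d → Sat φ (d ∷ ρ)
  Sat (∃̇ φ)   ρ = ∃[ d ] Sat φ (d ∷ ρ)

------------------------------------------------------------------------
-- The constructible hierarchy

-- The set of subsets of x definable over (x , ∈) with parameters from x
Def : V → V
Def x = sup
  (Σ[ n ∈ ℕ ] Formula (ℕ.suc n) × Vector (Index x) n)
  (λ (n , φ , ρ) → separate x (λ a → Sat (el x) φ (a ∷ ρ)))

-- L_γ = ⋃_{δ<γ} Def(L_δ), which covers the zero, successor and limit cases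
L : V → V
L (sup A f) = sup
  (Σ[ a ∈ A ] Index (Def (L (f a))))
  (λ (a , d) → el (Def (L (f a))) d)

Constructible : V → Set₁
Constructible x = Σ[ γ ∈ V ] Ordinal γ × x ∈ L γ

include : ∀ γ → Ordinal γ → Index (L γ) → Σ V Constructible
include γ o a = el (L γ) a , γ , o , a , ≈-refl (el (L γ) a)

-- L_γ ≺_{Σ₁} L
Σ₁-Elementary : ∀ γ → Ordinal γ → Set₁
Σ₁-Elementary γ o =
  ∀ {n} {φ : Formula n} → Σ₁ φ → (ρ : Vector (Index (L γ)) n) →
  Sat (el (L γ)) φ ρ ⇔ Sat {D = Σ V Constructible} proj₁ φ (λ i → include γ o (ρ i))

-- γ = σ_β
IsSigma : V → V → Set₁
IsSigma β γ =
  Σ[ o ∈ Ordinal γ ] β ∈ γ × Σ₁-Elementary γ o ×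
  (∀ δ (oδ : Ordinal δ) → β ∈ δ → Σ₁-Elementary δ oδ → γ ⊆ δ)

------------------------------------------------------------------------
-- Register machines

data Command (n : ℕ) : Set where
  increment : Fin n → Command n
  copy      : (source target : Fin n) → Command n
  jump      : Fin n → Fin n → (destination : ℕ) → Command n
  oracle    : Fin n → Command n

-- Programs using n registers.  The machine has halted once the active
-- line index is not the index of a line of the program.
Program : ℕ → Set
Program n = List (Command n)

record Config (n : ℕ) : Set₁ where
  constructor ⟨_,_⟩
  field
    line      : ℕ
    registers : Vector V n

open Config public

_≋_ : ∀ {n} → Vector V n → Vector V n → Set
r ≋ r′ = ∀ i → r i ≈ r′ i

-- The effect of a command, with oracle x
Execute : ∀ {n} → V → Command n → Config n → Config n → Set
Execute x (increment i) ⟨ l , r ⟩ ⟨ l′ , r′ ⟩ =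
  l′ ≡ ℕ.suc l × r′ ≋ updateAt r i succ
Execute x (copy i j)    ⟨ l , r ⟩ ⟨ l′ , r′ ⟩ =
  l′ ≡ ℕ.suc l × r′ ≋ updateAt r j (const (r i))
Execute x (jump i j m)  ⟨ l , r ⟩ ⟨ l′ , r′ ⟩ =
  ((r i ≈ r j × l′ ≡ m) ⊎ (¬ r i ≈ r j × l′ ≡ ℕ.suc l)) × r′ ≋ r
Execute x (oracle j)    ⟨ l , r ⟩ ⟨ l′ , r′ ⟩ =
  l′ ≡ ℕ.suc l ×
  ((r j ∈ x × r′ ≋ updateAt r j (const one)) ⊎
   (r j ∉ x × r′ ≋ updateAt r j (const ∅)))

Step : ∀ {n} → Program n → V → Config n → Config n → Set
Step P x c c′ =
  Σ[ active ∈ line c ℕ.< length P ] Execute x (lookup P (fromℕ< active)) c c′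

-- C is the sequence of configurations of P at the times t ≤ θ, with
-- oracle x and initial register contents r₀, as an α-wITRM.  Only the
-- values of C at times t ≤ θ matter.
record Run {n} (α : V) (P : Program n) (x : V) (r₀ : Vector V n)
           (θ : V) (C : V → Config n) : Set₁ where
  field
    line-cong      : ∀ {s t} → s ∈ succ θ → s ≈ t → line (C s) ≡ line (C t)
    registers-cong : ∀ {s t} → s ∈ succ θ → s ≈ t →
                     registers (C s) ≋ registers (C t)
    start-line      : line (C ∅) ≡ 0
    start-registers : registers (C ∅) ≋ r₀
    step            : ∀ {t} → t ∈ θ → Step P x (C t) (C (succ t))
    limit-line      : ∀ {t} → t ∈ succ θ → Limit t →
                      fromℕ (line (C t)) ≈ liminf t (λ s → fromℕ (line (C s)))
    limit-registers : ∀ {t} → t ∈ succ θ → Limit t → ∀ i →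
                      registers (C t) i ≈ liminf t (λ s → registers (C s) i)
    -- in particular, no register overflows at a limit time
    below           : ∀ {t} → t ∈ succ θ → ∀ i → registers (C t) i ∈ α

-- P^x(inputs)↓ = c for α-wITRMs: the inputs are in the first registers,
-- the k other registers start with 0, and the output is in the first one.
Computes : ∀ {m k} (α : V) → Program (ℕ.suc m ℕ.+ k) → (x : V) →
           Vector V (ℕ.suc m) → (c : V) → Set₁
Computes {m} {k} α P x inputs c =
  Σ[ θ ∈ V ] Σ[ C ∈ (V → Config (ℕ.suc m ℕ.+ k)) ]
    Ordinal θ ×
    Run α P x (inputs ++ replicate k ∅) θ C ×
    length P ℕ.≤ line (C θ) ×
    registers (C θ) zero ≈ c

-- Computations without an oracle are those with the empty oracle.
Computable : V → V → Set₁
Computable α x =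
  Σ[ k ∈ ℕ ] Σ[ P ∈ Program (2 ℕ.+ k) ] Σ[ ρ ∈ V ] ρ ∈ α ×
  (∀ ι → ι ∈ α →
     (ι ∈ x → Computes {1} {k} α P ∅ (ι ∷ ρ ∷ []) one) ×
     (ι ∉ x → Computes {1} {k} α P ∅ (ι ∷ ρ ∷ []) ∅))

-- The oracles y range over the constructible subsets of α.
Recognizable : V → V → Set₁
Recognizable α x =
  Σ[ k ∈ ℕ ] Σ[ P ∈ Program (1 ℕ.+ k) ] Σ[ ξ ∈ V ] ξ ∈ α ×
  (∀ y → y ⊆ α → Constructible y →
     (y ≈ x   → Computes {0} {k} α P y (ξ ∷ []) one) ×
     (¬ y ≈ x → Computes {0} {k} α P y (ξ ∷ []) ∅))

LostMelody : V → V → Set₁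
LostMelody α x = Recognizable α x × ¬ Computable α x

{-# OPTIONS --safe #-}

-- A halting computation of an α-wITRM is witnessed by a constructible set F of
-- snapshots, each justified by earlier snapshots in F.  "There are an ordinal
-- γ, an oracle y ⊆ γ and such an F describing an accepting run with all
-- registers below γ" is a Σ₁ statement with parameter ξ.  If x is recognized by
-- P with parameter ξ, it holds in L with γ = α and y = x, hence in L_α.  The
-- run so obtained with γ < α never queries the oracle at or above γ, so P
-- accepts y as well as y ∪ {γ}, although it accepts only one oracle.

module Submission where

open import Defs
open import Axiom.ExcludedMiddle using (ExcludedMiddle)
open import Data.Bool.Base using (Bool; true; false)
open import Data.Empty using (⊥-elim)
open import Data.Fin.Base using (Fin; zero; suc; splitAt; _↑ˡ_; _↑ʳ_; toℕ; fromℕ<)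
open import Data.Fin.Properties using (toℕ<n; fromℕ<-toℕ; toℕ-fromℕ<)
open import Data.List.Base using (length; lookup)
open import Data.Maybe.Base using (just; nothing)
open import Data.Nat.Base as ℕ using (ℕ; zero; suc)
open import Data.Nat.Properties using (<⇒≱)
open import Data.Product.Base using (Σ; Σ-syntax; ∃-syntax; _×_; _,_; proj₁; proj₂)
open import Data.Product.Function.NonDependent.Propositional using (_×-⇔_)
open import Data.Sum.Base as Sum using (_⊎_; inj₁; inj₂)
open import Data.Sum.Function.Propositional using (_⊎-⇔_)
open import Data.Vec.Functional using (Vector; []; _∷_; _++_; replicate; updateAt)
open import Data.Vec.Functional.Properties using (lookup-++ˡ; lookup-++ʳ)
open import Function.Base using (_∘_; const; id)
open import Function.Bundles using (_⇔_; mk⇔; Equivalence)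
open import Level using (Level; 0ℓ; lift)
open import Relation.Binary.PropositionalEquality.Core using (_≡_; refl; sym; trans; cong; subst)
open import Relation.Nullary.Decidable.Core using (yes; no)
open import Relation.Nullary.Negation.Core using (¬_)
open Equivalence using (to; from)

-- Sets and ordinals

-- The bound γ on the registers has to be quantified: α is not an element of `L α`, so the reflected
-- statement cannot mention it, whereas every ordinal that is an element of `L α` is less than α. It
-- is only ever compared with a run that is already given: for an oracle z other than x,
-- recognizability supplies a halting run with output 0, and induction on time shows that F records
-- only configurations of that run, provided that z agrees with y below γ. Hence y and y ∪ {γ} both
-- equal x. The opposite direction must find F inside L although the run is an arbitrary external
-- function of time. F is built by external recursion on time; at each stage the sets chosen so far,
-- whose choice has no definition in L, are absorbed into the union of all coherent sets in some
-- level of L. For this union to be coherent again, being justified must be monotone in F, which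
-- dictates the form of the limit clause.

≈-sym : ∀ {x y} → x ≈ y → y ≈ x
≈-sym {sup A f} {sup B g} (p , q) =
  (λ b → proj₁ (q b) , ≈-sym (proj₂ (q b))) ,
  (λ a → proj₁ (p a) , ≈-sym (proj₂ (p a)))

≈-trans : ∀ {x y z} → x ≈ y → y ≈ z → x ≈ z
≈-trans {sup A f} {sup B g} {sup C h} (p , q) (r , s) =
  (λ a → let b , e = p a ; c , e′ = r b in c , ≈-trans e e′) ,
  (λ c → let b , e = s c ; a , e′ = q b in a , ≈-trans e′ e)

≈-reflexive : ∀ {x y} → x ≡ y → x ≈ y
≈-reflexive {x} refl = ≈-refl x

el-∈ : ∀ x i → el x i ∈ x
el-∈ x i = i , ≈-refl (el x i)

⊆-antisym : ∀ x y → x ⊆ y → y ⊆ x → x ≈ y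
⊆-antisym (sup A f) (sup B g) p q =
  p , λ b → proj₁ (q b) , ≈-sym (proj₂ (q b))

≈⇒⊆ : ∀ x y → x ≈ y → x ⊆ y
≈⇒⊆ (sup A f) (sup B g) (p , _) = p

∈-respˡ : ∀ z {x y} → x ≈ y → x ∈ z → y ∈ z
∈-respˡ z e (i , e′) = i , ≈-trans (≈-sym e) e′

∈-⊆ : ∀ y z {x} → x ∈ y → y ⊆ z → x ∈ z
∈-⊆ y z (i , e) p = ∈-respˡ z (≈-sym e) (p i)

∈-respʳ : ∀ y z {x} → y ≈ z → x ∈ y → x ∈ z
∈-respʳ y z e m = ∈-⊆ y z m (≈⇒⊆ y z e)

⊆-trans : ∀ x y z → x ⊆ y → y ⊆ z → x ⊆ z
⊆-trans x y z p q i = ∈-⊆ y z (p i) q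

∈⇒⊆ : ∀ x y → Transitive y → x ∈ y → x ⊆ y
∈⇒⊆ x y t (i , e) = ⊆-trans x (el y i) y (≈⇒⊆ x (el y i) e) (t i)

∈-trans : ∀ y z {x} → Transitive z → x ∈ y → y ∈ z → x ∈ z
∈-trans y z t m m′ = ∈-⊆ y z m (∈⇒⊆ y z t m′)

∈-irrefl : ∀ x → x ∉ x
∈-irrefl (sup A f) (a , e) =
  ∈-irrefl (f a) (∈-respʳ (sup A f) (f a) e (el-∈ (sup A f) a))

∈-succ⁻ : ∀ y {x} → x ∈ succ y → x ∈ y ⊎ x ≈ y
∈-succ⁻ y (just i , e)  = inj₁ (i , e)
∈-succ⁻ y (nothing , e) = inj₂ e

∈-succ⁺ : ∀ y {x} → x ∈ y ⊎ x ≈ y → x ∈ succ y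
∈-succ⁺ y (inj₁ (i , e)) = just i , e
∈-succ⁺ y (inj₂ e)       = nothing , e

self-∈-succ : ∀ x → x ∈ succ x
self-∈-succ x = nothing , ≈-refl x

succ-⊆ : ∀ x y → x ⊆ y → x ∈ y → succ x ⊆ y
succ-⊆ x y p m (just i) = p i
succ-⊆ x y p m nothing  = m

⊆-succ : ∀ x → x ⊆ succ x
⊆-succ x i = just i , ≈-refl (el x i)

succ-mono : ∀ x y → x ≈ y → succ x ⊆ succ y
succ-mono x y e (just i) = ∈-succ⁺ y (inj₁ (≈⇒⊆ x y e i))
succ-mono x y e nothing  = ∈-succ⁺ y (inj₂ e)

succ-cong : ∀ x y → x ≈ y → succ x ≈ succ y
succ-cong x y e =
  ⊆-antisym (succ x) (succ y) (succ-mono x y e) (succ-mono y x (≈-sym e))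

∅-⊆ : ∀ x → ∅ ⊆ x
∅-⊆ x ()

succ≉∅ : ∀ x → ¬ succ x ≈ ∅
succ≉∅ x e with () ← proj₁ (≈⇒⊆ (succ x) ∅ e nothing)

Transitive-resp : ∀ x y → x ≈ y → Transitive x → Transitive y
Transitive-resp x y e t i =
  ⊆-trans (el y i) x y
    (∈⇒⊆ (el y i) x t (≈⇒⊆ y x (≈-sym e) i)) (≈⇒⊆ x y e)

Ordinal-∈ : ∀ x y → Ordinal y → x ∈ y → Ordinal x
Ordinal-∈ x y (t , t′) (i , e) =
  Transitive-resp (el y i) x (≈-sym e) (t′ i) ,
  λ j → let k , e′ = ∈-trans x y t (el-∈ x j) (i , e)
        in Transitive-resp (el y k) (el x j) (≈-sym e′) (t′ k)

Ordinal-succ : ∀ x → Ordinal x → Ordinal (succ x)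
Ordinal-succ x (t , t′) =
  (λ { (just i) → ⊆-trans (el x i) x (succ x) (t i) (⊆-succ x)
     ; nothing → ⊆-succ x }) ,
  (λ { (just i) → t′ i ; nothing → t })

Ordinal-∅ : Ordinal ∅
Ordinal-∅ = (λ ()) , (λ ())

Ordinal-fromℕ : ∀ l → Ordinal (fromℕ l)
Ordinal-fromℕ zero    = Ordinal-∅
Ordinal-fromℕ (suc l) = Ordinal-succ (fromℕ l) (Ordinal-fromℕ l)

∈-asym : ∀ x y → Ordinal x → x ∈ y → y ∉ x
∈-asym x y o m m′ = ∈-irrefl x (∈-trans y x (proj₁ o) m m′)

succ-injective : ∀ x y → Ordinal x → succ x ≈ succ y → x ≈ y
succ-injective x y o e
  with ∈-succ⁻ y (≈⇒⊆ (succ x) (succ y) e nothing)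
     | ∈-succ⁻ x (≈⇒⊆ (succ y) (succ x) (≈-sym {succ x} {succ y} e) nothing)
... | inj₂ e′ | _       = e′
... | inj₁ _  | inj₂ e′ = ≈-sym e′
... | inj₁ m  | inj₁ m′ = ⊥-elim (∈-asym x y o m m′)

fromℕ-injective : ∀ k l → fromℕ k ≈ fromℕ l → k ≡ l
fromℕ-injective zero    zero    e = refl
fromℕ-injective zero    (suc l) e =
  ⊥-elim (succ≉∅ (fromℕ l) (≈-sym {∅} {succ (fromℕ l)} e))
fromℕ-injective (suc k) zero    e = ⊥-elim (succ≉∅ (fromℕ k) e)
fromℕ-injective (suc k) (suc l) e =
  cong suc (fromℕ-injective k l
    (succ-injective (fromℕ k) (fromℕ l) (Ordinal-fromℕ k) e))

-- The union of the successors: every f a is one of its elements literally,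
-- so no congruence of L is needed to compare L (f a) with L (lub A f).
lub : (A : Set) → (A → V) → V
lub A f = sup (Σ[ a ∈ A ] Index (succ (f a))) (λ (a , i) → el (succ (f a)) i)

Ordinal-lub : ∀ {A} (f : A → V) → (∀ a → Ordinal (f a)) → Ordinal (lub A f)
Ordinal-lub f o =
  (λ (a , i) j → let k , e = proj₁ (Ordinal-succ (f a) (o a)) i j
                 in (a , k) , e) ,
  (λ (a , i) → proj₂ (Ordinal-succ (f a) (o a)) i)

module Classical (em : ExcludedMiddle 0ℓ) where

  dne : {P : Set} → ¬ ¬ P → P
  dne {P} h with em {P}
  ... | yes p = p
  ... | no np = ⊥-elim (h np)

  ¬∀⇒∃¬ : {A : Set} {P : A → Set} → ¬ (∀ a → P a) → ∃[ a ] ¬ P a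
  ¬∀⇒∃¬ h = dne λ h′ → h λ a → dne λ np → h′ (a , np)

  -- The inductive step of `trichotomy`, with the comparisons of elements as hypotheses: an element
  -- of y outside x is comparable with x, which forces `x ∈ y`, and symmetrically.
  comparable : ∀ x y → Transitive x → Transitive y →
    (∀ i → el x i ∈ y ⊎ el x i ≈ y ⊎ y ∈ el x i) →
    (∀ j → x ∈ el y j ⊎ x ≈ el y j ⊎ el y j ∈ x) →
    x ∈ y ⊎ x ≈ y ⊎ y ∈ x
  comparable x y tx ty h k with em {x ⊆ y} | em {y ⊆ x}
  ... | yes p | yes q = inj₂ (inj₁ (⊆-antisym x y p q))
  ... | _ | no q with j , nj ← ¬∀⇒∃¬ q with k j
  ...   | inj₁ m        = inj₁ (∈-trans (el y j) y ty m (el-∈ y j))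
  ...   | inj₂ (inj₁ e) = inj₁ (j , e)
  ...   | inj₂ (inj₂ m) = ⊥-elim (nj m)
  comparable x y tx ty h k | no p | yes _ with i , ni ← ¬∀⇒∃¬ p with h i
  ...   | inj₁ m        = ⊥-elim (ni m)
  ...   | inj₂ (inj₁ e) = inj₂ (inj₂ (i , ≈-sym e))
  ...   | inj₂ (inj₂ m) = inj₂ (inj₂ (∈-trans (el x i) x tx m (el-∈ x i)))

  trichotomy : ∀ x y → Ordinal x → Ordinal y → x ∈ y ⊎ x ≈ y ⊎ y ∈ x
  trichotomy x@(sup A f) y@(sup B g) ox oy =
    comparable x y (proj₁ ox) (proj₁ oy)
      (λ a → trichotomy (f a) (sup B g) (Ordinal-∈ (f a) x ox (el-∈ x a)) oy)
      (λ b → trichotomy (sup A f) (g b) ox (Ordinal-∈ (g b) y oy (el-∈ y b)))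

  ⊆⇒∈-succ : ∀ x y → Ordinal x → Ordinal y → x ⊆ y → x ∈ succ y
  ⊆⇒∈-succ x y ox oy p with trichotomy x y ox oy
  ... | inj₁ m        = ∈-succ⁺ y (inj₁ m)
  ... | inj₂ (inj₁ e) = ∈-succ⁺ y (inj₂ e)
  ... | inj₂ (inj₂ m) = ⊥-elim (∈-irrefl y (∈-⊆ x y m p))

  succ-∈-succ : ∀ x y → Ordinal y → x ∈ y → succ x ∈ succ y
  succ-∈-succ x y oy m =
    ⊆⇒∈-succ (succ x) y (Ordinal-succ x (Ordinal-∈ x y oy m)) oy
      (succ-⊆ x y (∈⇒⊆ x y (proj₁ oy) m) m)

  -- If some `succ (el x i)` is missing from x, it is still an element of `succ x` and therefore
  -- equals x.
  zero-succ-limit : ∀ x → Ordinal x →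
    x ≈ ∅ ⊎ (∃[ i ] x ≈ succ (el x i)) ⊎ Limit x
  zero-succ-limit x o with em {Index x}
  ... | no ni = inj₁ (⊆-antisym x ∅ (λ i → ⊥-elim (ni i)) (∅-⊆ x))
  ... | yes i₀ with em {∀ i → succ (el x i) ∈ x}
  ...   | yes l = inj₂ (inj₂ (i₀ , l))
  ...   | no nl with i , ns ← ¬∀⇒∃¬ nl
        with ∈-succ⁻ x (succ-∈-succ (el x i) x o (el-∈ x i))
  ...     | inj₁ m = ⊥-elim (ns m)
  ...     | inj₂ e = inj₂ (inj₁ (i , ≈-sym {succ (el x i)} {x} e))

-- Δ₀ definability

-- Truth in V, with bounded quantifiers read over the index type of the bound. Unlike `Sat` over a
-- proper class this is a small type, so it can be used in `separate` and decided by excluded middle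
-- at level zero. Truth in `L α` and truth in L are both compared with it.
Holds : ∀ {n} {φ : Formula n} → Δ₀ φ → Vector V n → Set
Holds (mem {i = i} {j}) σ = σ i ∈ σ j
Holds (eq {i = i} {j})  σ = σ i ≈ σ j
Holds (neg d)           σ = ¬ Holds d σ
Holds (conj d d′)       σ = Holds d σ × Holds d′ σ
Holds (disj d d′)       σ = Holds d σ ⊎ Holds d′ σ
Holds (impl d d′)       σ = Holds d σ → Holds d′ σ
Holds (all∈ {i = i} d)  σ = ∀ k → Holds d (el (σ i) k ∷ σ)
Holds (ex∈ {i = i} d)   σ = ∃[ k ] Holds d (el (σ i) k ∷ σ)

module _ {ℓ : Level} {D : Set ℓ} (⟦_⟧ : D → V)
         (transitive : ∀ d i → ∃[ d′ ] ⟦ d′ ⟧ ≈ el ⟦ d ⟧ i) where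

  private
    infixr 5 _∷≈_
    _∷≈_ : ∀ {n d x} {ρ : Vector D n} {σ : Vector V n} →
      ⟦ d ⟧ ≈ x → (∀ i → ⟦ ρ i ⟧ ≈ σ i) → ∀ i → ⟦ (d ∷ ρ) i ⟧ ≈ (x ∷ σ) i
    (p ∷≈ q) zero    = p
    (p ∷≈ q) (suc i) = q i

  -- Since every element of a denoted set is denoted again, a quantifier over the domain that is
  -- bounded by `ρ i` has the same range, up to `≈`, as the elements of `σ i`.
  Δ₀-absolute : ∀ {n} {φ : Formula n} (d : Δ₀ φ) (ρ : Vector D n) (σ : Vector V n) →
    (∀ i → ⟦ ρ i ⟧ ≈ σ i) → Sat ⟦_⟧ φ ρ ⇔ Holds d σ
  Δ₀-absolute (mem {i = i} {j}) ρ σ h = mk⇔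
    (λ (lift m) → ∈-respˡ (σ j) (h i) (∈-respʳ ⟦ ρ j ⟧ (σ j) (h j) m))
    (λ m → lift (∈-respˡ ⟦ ρ j ⟧ (≈-sym (h i))
                  (∈-respʳ (σ j) ⟦ ρ j ⟧ (≈-sym (h j)) m)))
  Δ₀-absolute (eq {i = i} {j}) ρ σ h = mk⇔
    (λ (lift e) → ≈-trans (≈-sym (h i)) (≈-trans e (h j)))
    (λ e → lift (≈-trans (h i) (≈-trans e (≈-sym (h j)))))
  Δ₀-absolute (neg d) ρ σ h =
    let p = Δ₀-absolute d ρ σ h in mk⇔ (_∘ from p) (_∘ to p)
  Δ₀-absolute (conj d d′) ρ σ h = Δ₀-absolute d ρ σ h ×-⇔ Δ₀-absolute d′ ρ σ h
  Δ₀-absolute (disj d d′) ρ σ h = Δ₀-absolute d ρ σ h ⊎-⇔ Δ₀-absolute d′ ρ σ h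
  Δ₀-absolute (impl d d′) ρ σ h =
    let p = Δ₀-absolute d ρ σ h ; q = Δ₀-absolute d′ ρ σ h
    in mk⇔ (λ f → to q ∘ f ∘ from p) (λ f → from q ∘ f ∘ to p)
  Δ₀-absolute (all∈ {i = i} d) ρ σ h = mk⇔
    (λ f k → let j , e = ≈⇒⊆ (σ i) ⟦ ρ i ⟧ (≈-sym (h i)) k
                 x , e′ = transitive (ρ i) j
             in to (Δ₀-absolute d (x ∷ ρ) (el (σ i) k ∷ σ)
                     (≈-trans e′ (≈-sym e) ∷≈ h))
                   (f x (lift (j , e′))))
    (λ f x (lift m) → let k , e = ∈-respʳ ⟦ ρ i ⟧ (σ i) (h i) m
                      in from (Δ₀-absolute d (x ∷ ρ) (el (σ i) k ∷ σ) (e ∷≈ h)) (f k))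
  Δ₀-absolute (ex∈ {i = i} d) ρ σ h = mk⇔
    (λ (x , lift m , s) →
      let k , e = ∈-respʳ ⟦ ρ i ⟧ (σ i) (h i) m
      in k , to (Δ₀-absolute d (x ∷ ρ) (el (σ i) k ∷ σ) (e ∷≈ h)) s)
    (λ (k , s) →
      let j , e = ≈⇒⊆ (σ i) ⟦ ρ i ⟧ (≈-sym (h i)) k
          x , e′ = transitive (ρ i) j
      in x , lift (j , e′) ,
         from (Δ₀-absolute d (x ∷ ρ) (el (σ i) k ∷ σ) (≈-trans e′ (≈-sym e) ∷≈ h)) s)

-- Absoluteness for the domain V itself, applied to one valuation and two lists that it matches.
Holds-cong : ∀ {n} {φ : Formula n} (d : Δ₀ φ) {σ σ′ : Vector V n} →
  σ ≋ σ′ → Holds d σ ⇔ Holds d σ′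
Holds-cong d {σ} {σ′} h = mk⇔
  (λ p → to (V-absolute h) (from (V-absolute (λ i → ≈-refl (σ i))) p))
  (λ p → to (V-absolute (λ i → ≈-refl (σ i))) (from (V-absolute h) p))
  where
  V-absolute : ∀ {σ″} → σ ≋ σ″ → Sat id _ σ ⇔ Holds d σ″
  V-absolute = Δ₀-absolute id (λ x i → el x i , ≈-refl (el x i)) d σ _

-- P is a Δ₀ property of the sets listed by v.  The environment e : E is kept
-- apart from the list v e, so that P can mention sets by name instead of by
-- their position in a vector.
record Definable {E : Set₁} {m} (v : E → Vector V m) (P : E → Set) : Set₁ where
  constructor definable
  field
    {formula} : Formula m
    isΔ₀      : Δ₀ formula
    correct   : ∀ e → Holds isΔ₀ (v e) ⇔ P e

-- The equation is propositional because a variable weakened past a block of variable length is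
-- looked up in an `_++_`, which does not reduce.
record Var {E : Set₁} {m} (v : E → Vector V m) (τ : E → V) : Set₁ where
  constructor var
  field
    index   : Fin m
    denotes : ∀ e → v e index ≡ τ e

infixl 5 _▸ _▸^_

_▸ : ∀ {E : Set₁} {m} → (E → Vector V m) → E × V → Vector V (suc m)
(v ▸) (e , z) = z ∷ v e

_▸^_ : ∀ {E : Set₁} {m} → (E → Vector V m) → ∀ k → E × Vector V k → Vector V (k ℕ.+ m)
(v ▸^ k) (e , us) = us ++ v e

module _ {E : Set₁} {m} {v : E → Vector V m} where

  new : Var (v ▸) proj₂
  new = var zero λ _ → refl

  wk : ∀ {τ} → Var v τ → Var (v ▸) (τ ∘ proj₁)
  wk (var i h) = var (suc i) (h ∘ proj₁)

  new^ : ∀ {k} (i : Fin k) → Var (v ▸^ k) (λ e → proj₂ e i)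
  new^ {k} i = var (i ↑ˡ m) λ (e , us) → lookup-++ˡ us (v e) i

  wk^ : ∀ {k τ} → Var v τ → Var (v ▸^ k) (τ ∘ proj₁)
  wk^ {k} (var i h) = var (k ↑ʳ i) λ (e , us) → trans (lookup-++ʳ us (v e) i) (h e)

  Δ-resp : ∀ {P Q} → (∀ e → P e ⇔ Q e) → Definable v P → Definable v Q
  Δ-resp h (definable d c) = definable d λ e →
    mk⇔ (to (h e) ∘ to (c e)) (from (c e) ∘ from (h e))

  infix  4 _∈ᵈ_ _≈ᵈ_
  infixr 3 _∧ᵈ_
  infixr 2 _∨ᵈ_
  infixr 1 _⇒ᵈ_

  _∈ᵈ_ : ∀ {τ υ} → Var v τ → Var v υ → Definable v (λ e → τ e ∈ υ e)
  _∈ᵈ_ {τ} {υ} (var i h) (var j k) = definable (mem {i = i} {j}) λ e →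
    mk⇔ (λ m → subst (λ x → x ∈ υ e) (h e) (subst (v e i ∈_) (k e) m))
        (λ m → subst (v e i ∈_) (sym (k e)) (subst (λ x → x ∈ υ e) (sym (h e)) m))

  _≈ᵈ_ : ∀ {τ υ} → Var v τ → Var v υ → Definable v (λ e → τ e ≈ υ e)
  _≈ᵈ_ {τ} {υ} (var i h) (var j k) = definable (eq {i = i} {j}) λ e →
    mk⇔ (λ m → subst (_≈ υ e) (h e) (subst (v e i ≈_) (k e) m))
        (λ m → subst (v e i ≈_) (sym (k e)) (subst (_≈ υ e) (sym (h e)) m))

  ¬ᵈ_ : ∀ {P} → Definable v P → Definable v (λ e → ¬ P e)
  ¬ᵈ definable d c = definable (neg d) λ e → mk⇔ (_∘ from (c e)) (_∘ to (c e))

  _∧ᵈ_ : ∀ {P Q} → Definable v P → Definable v Q → Definable v (λ e → P e × Q e)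
  definable d c ∧ᵈ definable d′ c′ = definable (conj d d′) λ e → c e ×-⇔ c′ e

  _∨ᵈ_ : ∀ {P Q} → Definable v P → Definable v Q → Definable v (λ e → P e ⊎ Q e)
  definable d c ∨ᵈ definable d′ c′ = definable (disj d d′) λ e → c e ⊎-⇔ c′ e

  _⇒ᵈ_ : ∀ {P Q} → Definable v P → Definable v Q → Definable v (λ e → P e → Q e)
  definable d c ⇒ᵈ definable d′ c′ = definable (impl d d′) λ e →
    mk⇔ (λ f → to (c′ e) ∘ f ∘ from (c e)) (λ f → from (c′ e) ∘ f ∘ to (c e))

  ∀∈ᵈ : ∀ {τ P} → Var v τ → Definable (v ▸) P →
    Definable v (λ e → ∀ i → P (e , el (τ e) i))
  ∀∈ᵈ {τ} {P} (var i h) (definable d c) = definable (all∈ {i = i} d) λ e →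
    subst (λ x → (∀ k → Holds d (el x k ∷ v e)) ⇔ (∀ k → P (e , el (τ e) k)))
      (sym (h e))
      (mk⇔ (λ f k → to (c (e , el (τ e) k)) (f k))
           (λ f k → from (c (e , el (τ e) k)) (f k)))

  ∃∈ᵈ : ∀ {τ P} → Var v τ → Definable (v ▸) P →
    Definable v (λ e → ∃[ i ] P (e , el (τ e) i))
  ∃∈ᵈ {τ} {P} (var i h) (definable d c) = definable (ex∈ {i = i} d) λ e →
    subst (λ x → (∃[ k ] Holds d (el x k ∷ v e)) ⇔ (∃[ k ] P (e , el (τ e) k)))
      (sym (h e))
      (mk⇔ (λ (k , p) → k , to (c (e , el (τ e) k)) p)
           (λ (k , p) → k , from (c (e , el (τ e) k)) p))

  -- The language has no constant for truth; the variable serves to write the empty conjunction as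
  -- `x ≈ᵈ x`.
  ∀ᶠᵈ : ∀ {k} {P : Fin k → E → Set} {τ} → Var v τ →
    (∀ i → Definable v (P i)) → Definable v (λ e → ∀ i → P i e)
  ∀ᶠᵈ {zero} x h = Δ-resp (λ e → mk⇔ (λ _ ()) (λ _ → ≈-refl _)) (x ≈ᵈ x)
  ∀ᶠᵈ {suc k} x h = Δ-resp
    (λ e → mk⇔ (λ { (p , q) zero → p ; (p , q) (suc i) → q i })
               (λ f → f zero , f ∘ suc))
    (h zero ∧ᵈ ∀ᶠᵈ x (h ∘ suc))

  ∃ᶠᵈ : ∀ {k} {P : Fin k → E → Set} {τ} → Var v τ →
    (∀ i → Definable v (P i)) → Definable v (λ e → ∃[ i ] P i e)
  ∃ᶠᵈ {zero} x h = Δ-resp (λ e → mk⇔ (λ f → ⊥-elim (f (≈-refl _))) (λ ())) (¬ᵈ (x ≈ᵈ x))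
  ∃ᶠᵈ {suc k} x h = Δ-resp
    (λ e → mk⇔ (λ { (inj₁ p) → zero , p ; (inj₂ (i , p)) → suc i , p })
               (λ { (zero , p) → inj₁ p ; (suc i , p) → inj₂ (i , p) }))
    (h zero ∨ᵈ ∃ᶠᵈ x (h ∘ suc))

∃^-formula : ∀ k {m} {φ : Formula (k ℕ.+ m)} (b : Fin m) → Δ₀ φ → Σ (Formula m) Δ₀
∃^-formula zero    b d = _ , d
∃^-formula (suc k) b d = ∃^-formula k b (ex∈ {i = k ↑ʳ b} d)

∃^-correct : ∀ k {m} {φ : Formula (k ℕ.+ m)} (b : Fin m) (d : Δ₀ φ) (σ : Vector V m) →
  Holds (proj₂ (∃^-formula k b d)) σ ⇔
  (Σ[ is ∈ (Fin k → Index (σ b)) ] Holds d ((λ j → el (σ b) (is j)) ++ σ))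
∃^-correct zero b d σ = mk⇔
  (λ p → (λ ()) , to (Holds-cong d (λ i → ≈-refl (σ i))) p)
  (λ (_ , p) → from (Holds-cong d (λ i → ≈-refl (σ i))) p)
∃^-correct (suc k) b d σ = mk⇔
  (λ p → let is , p′ = to (∃^-correct k b (ex∈ {i = k ↑ʳ b} d) σ) p
             i , q = subst (λ x → ∃[ i ] Holds d (el x i ∷ (el (σ b) ∘ is) ++ σ))
                       (lookup-++ʳ (el (σ b) ∘ is) σ b) p′
         in (i ∷ is) , to (Holds-cong d (∷-++ (i ∷ is))) q)
  (λ (is , q) → from (∃^-correct k b (ex∈ {i = k ↑ʳ b} d) σ)
    ((is ∘ suc) ,
     subst (λ x → ∃[ i ] Holds d (el x i ∷ (el (σ b) ∘ is ∘ suc) ++ σ))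
       (sym (lookup-++ʳ (el (σ b) ∘ is ∘ suc) σ b))
       (is zero , from (Holds-cong d (∷-++ is)) q)))
  where
  -- The two lists are equal only pointwise, so `Holds-cong` has to carry truth from one to the
  -- other.
  ∷-++ : ∀ (is : Fin (suc k) → Index (σ b)) →
    (el (σ b) (is zero) ∷ (el (σ b) ∘ is ∘ suc) ++ σ) ≋ ((el (σ b) ∘ is) ++ σ)
  ∷-++ is zero    = ≈-refl _
  ∷-++ is (suc j) with splitAt k j
  ... | inj₁ _ = ≈-refl _
  ... | inj₂ _ = ≈-refl _

module _ {E : Set₁} {m} {v : E → Vector V m} where

  ∃^ᵈ : ∀ {k τ P} → Var v τ → Definable (v ▸^ k) P →
    Definable v (λ e → Σ[ is ∈ (Fin k → Index (τ e)) ] P (e , el (τ e) ∘ is))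
  ∃^ᵈ {k} {τ} {P} (var b h) (definable d c) =
    definable (proj₂ (∃^-formula k b d)) λ e →
      subst (λ x → Holds (proj₂ (∃^-formula k b d)) (v e) ⇔
                   (Σ[ is ∈ (Fin k → Index x) ] P (e , el x ∘ is)))
        (h e)
        (mk⇔ (λ p → let is , q = to (∃^-correct k b d (v e)) p
                    in is , to (c (e , el (v e b) ∘ is)) q)
             (λ (is , q) → from (∃^-correct k b d (v e))
                             (is , from (c (e , el (v e b) ∘ is)) q)))

  module _ (em : ExcludedMiddle 0ℓ) where
    open Classical em

    -- Written as a negated `∃^ᵈ`; excluded middle thus spares a second induction over blocks of
    -- quantifiers.
    ∀^ᵈ : ∀ {k τ P} → Var v τ → Definable (v ▸^ k) P →
      Definable v (λ e → ∀ (is : Fin k → Index (τ e)) → P (e , el (τ e) ∘ is))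
    ∀^ᵈ x p = Δ-resp
      (λ e → mk⇔ (λ h is → dne λ n → h (is , n)) (λ h (is , n) → n (h is)))
      (¬ᵈ ∃^ᵈ x (¬ᵈ p))

  infix 4 _⊆ᵈ_
  _⊆ᵈ_ : ∀ {τ υ} → Var v τ → Var v υ → Definable v (λ e → τ e ⊆ υ e)
  x ⊆ᵈ y = ∀∈ᵈ x (new ∈ᵈ wk y)

  ≈∅ᵈ : ∀ {τ} → Var v τ → Definable v (λ e → τ e ≈ ∅)
  ≈∅ᵈ {τ} x = Δ-resp
    (λ e → mk⇔ (λ h → ⊆-antisym (τ e) ∅ (λ i → ⊥-elim (h i (≈-refl _))) (∅-⊆ (τ e)))
               (λ h i → ⊥-elim (proj₁ (≈⇒⊆ (τ e) ∅ h i))))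
    (∀∈ᵈ x (¬ᵈ (new ≈ᵈ new)))

module _ {E : Set₁} {m} {v : E → Vector V m} where

  ≈succᵈ : ∀ {τ υ} → Var v τ → Var v υ → Definable v (λ e → τ e ≈ succ (υ e))
  ≈succᵈ {τ} {υ} x y = Δ-resp
    (λ e → mk⇔
      (λ (p , q , r) → ⊆-antisym (τ e) (succ (υ e))
        (λ i → ∈-succ⁺ (υ e) (p i)) (succ-⊆ (υ e) (τ e) q r))
      (λ h → (λ i → ∈-succ⁻ (υ e) (≈⇒⊆ (τ e) (succ (υ e)) h i)) ,
             (λ i → ≈⇒⊆ (succ (υ e)) (τ e) (≈-sym {τ e} {succ (υ e)} h) (just i)) ,
             ≈⇒⊆ (succ (υ e)) (τ e) (≈-sym {τ e} {succ (υ e)} h) nothing))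
    (∀∈ᵈ x (new ∈ᵈ wk y ∨ᵈ new ≈ᵈ wk y) ∧ᵈ y ⊆ᵈ x ∧ᵈ y ∈ᵈ x)

  Transitiveᵈ : ∀ {τ} → Var v τ → Definable v (λ e → Transitive (τ e))
  Transitiveᵈ x = ∀∈ᵈ x (new ⊆ᵈ wk x)

-- The predecessor is an element of the successor, so the recursion on l only adds bounded
-- quantifiers.
≈fromℕᵈ : ∀ {E : Set₁} {m} {v : E → Vector V m} {τ} l → Var v τ →
  Definable v (λ e → τ e ≈ fromℕ l)
≈fromℕᵈ zero x = ≈∅ᵈ x
≈fromℕᵈ {τ = τ} (suc l) x = Δ-resp
  (λ e → mk⇔
    (λ (i , p , q) → ≈-trans {τ e} {succ (el (τ e) i)} {fromℕ (suc l)} p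
                       (succ-cong (el (τ e) i) (fromℕ l) q))
    (λ h → let i , p = ≈⇒⊆ (fromℕ (suc l)) (τ e) (≈-sym {τ e} {fromℕ (suc l)} h) nothing
           in i , ≈-trans {τ e} {fromℕ (suc l)} {succ (el (τ e) i)} h
                    (succ-cong (fromℕ l) (el (τ e) i) p) , ≈-sym p))
  (∃∈ᵈ x (≈succᵈ (wk x) new ∧ᵈ ≈fromℕᵈ l new))

-- x ∈ y in the form in which membership of a defined set x is expressed
-- by a formula.
∃≈⇔∈ : ∀ x y → (∃[ i ] el y i ≈ x) ⇔ x ∈ y
∃≈⇔∈ x y = mk⇔ (λ (i , e) → i , ≈-sym {el y i} {x} e)
               (λ (i , e) → i , ≈-sym {x} {el y i} e)

-- Kuratowski pairs and codes of tuples

⁅_,_⁆ : V → V → V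
⁅ x , y ⁆ = sup Bool λ { true → x ; false → y }

pair : V → V → V
pair x y = ⁅ ⁅ x , x ⁆ , ⁅ x , y ⁆ ⁆

code : ∀ {k} → Vector V (suc k) → V
code {zero}  us = us zero
code {suc k} us = pair (us zero) (code (us ∘ suc))

≈⁅⁆⇔ : ∀ x y p → (x ∈ p × y ∈ p × (∀ i → el p i ≈ x ⊎ el p i ≈ y)) ⇔ p ≈ ⁅ x , y ⁆
≈⁅⁆⇔ x y p = mk⇔
  (λ (q , r , h) → ⊆-antisym p ⁅ x , y ⁆
    (λ i → Sum.[ true ,_ , false ,_ ]′ (h i))
    (λ { true → q ; false → r }))
  (λ h → let h′ = ≈-sym {p} {⁅ x , y ⁆} h in
    ≈⇒⊆ ⁅ x , y ⁆ p h′ true , ≈⇒⊆ ⁅ x , y ⁆ p h′ false ,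
    λ i → ∈-⁅⁆⁻ (≈⇒⊆ p ⁅ x , y ⁆ h i))
  where
  ∈-⁅⁆⁻ : ∀ {z} → z ∈ ⁅ x , y ⁆ → z ≈ x ⊎ z ≈ y
  ∈-⁅⁆⁻ (true , e)  = inj₁ e
  ∈-⁅⁆⁻ (false , e) = inj₂ e

⁅⁆-cong : ∀ {x x′ y y′} → x ≈ x′ → y ≈ y′ → ⁅ x , y ⁆ ≈ ⁅ x′ , y′ ⁆
⁅⁆-cong p q =
  (λ { true → true , p ; false → false , q }) ,
  (λ { true → true , p ; false → false , q })

pair-cong : ∀ {x x′ y y′} → x ≈ x′ → y ≈ y′ → pair x y ≈ pair x′ y′
pair-cong p q = ⁅⁆-cong (⁅⁆-cong p p) (⁅⁆-cong p q)

code-cong : ∀ {k} {us vs : Vector V (suc k)} → us ≋ vs → code us ≈ code vs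
code-cong {zero}  h = h zero
code-cong {suc k} h = pair-cong (h zero) (code-cong (h ∘ suc))

pair-injective : ∀ x y x′ y′ → pair x y ≈ pair x′ y′ → x ≈ x′ × y ≈ y′
pair-injective x y x′ y′ (h , k) = x≈x′ , y≈y′ (h false) (k false)
  where
  ⁅⁆-injectiveˡ : ∀ {a b c} → ⁅ a , a ⁆ ≈ ⁅ b , c ⁆ → a ≈ b × a ≈ c
  ⁅⁆-injectiveˡ (_ , k) with k true | k false
  ... | true  , p | true  , q = p , q
  ... | true  , p | false , q = p , q
  ... | false , p | true  , q = p , q
  ... | false , p | false , q = p , q

  ⁅⁆-second : ∀ {a b c} → ⁅ a , b ⁆ ≈ ⁅ a , c ⁆ → b ≈ c
  ⁅⁆-second (h , k) with h false | k false
  ... | false , p | _         = p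
  ... | true  , p | true  , q = ≈-trans p q
  ... | true  , p | false , q = q

  x≈x′ : x ≈ x′
  x≈x′ with h true
  ... | true  , p = proj₁ (⁅⁆-injectiveˡ p)
  ... | false , p = proj₁ (⁅⁆-injectiveˡ p)

  y≈y′ : ⁅ x , y ⁆ ∈ pair x′ y′ → (∃[ b ] el (pair x y) b ≈ ⁅ x′ , y′ ⁆) → y ≈ y′
  y≈y′ (false , p) _ =
    ⁅⁆-second (≈-trans {⁅ x , y ⁆} {⁅ x′ , y′ ⁆} {⁅ x , y′ ⁆} p
      (⁅⁆-cong (≈-sym x≈x′) (≈-refl y′)))
  y≈y′ (true , _) (false , q) =
    ⁅⁆-second (≈-trans {⁅ x , y ⁆} {⁅ x′ , y′ ⁆} {⁅ x , y′ ⁆} q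
      (⁅⁆-cong (≈-sym x≈x′) (≈-refl y′)))
  y≈y′ (true , p) (true , q) =
    ≈-trans (≈-sym (proj₂ (⁅⁆-injectiveˡ
              (≈-sym {⁅ x , y ⁆} {⁅ x′ , x′ ⁆} p))))
            (≈-trans (≈-sym x≈x′) (proj₂ (⁅⁆-injectiveˡ q)))

code-injective : ∀ {k} (us vs : Vector V (suc k)) → code us ≈ code vs → us ≋ vs
code-injective {zero}  us vs h zero = h
code-injective {suc k} us vs h =
  let p , q = pair-injective (us zero) (code (us ∘ suc)) (vs zero) (code (vs ∘ suc)) h
  in λ { zero → p ; (suc i) → code-injective (us ∘ suc) (vs ∘ suc) q i }

≈⁅⁆ᵈ : ∀ {E : Set₁} {m} {v : E → Vector V m} {π τ υ} →
  Var v π → Var v τ → Var v υ → Definable v (λ e → π e ≈ ⁅ τ e , υ e ⁆)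
≈⁅⁆ᵈ {π = π} {τ} {υ} p x y = Δ-resp (λ e → ≈⁅⁆⇔ (τ e) (υ e) (π e))
  (x ∈ᵈ p ∧ᵈ y ∈ᵈ p ∧ᵈ ∀∈ᵈ p (new ≈ᵈ wk x ∨ᵈ new ≈ᵈ wk y))

≈pairᵈ : ∀ {E : Set₁} {m} {v : E → Vector V m} {π τ υ} →
  Var v π → Var v τ → Var v υ → Definable v (λ e → π e ≈ pair (τ e) (υ e))
≈pairᵈ {π = π} {τ} {υ} p x y = Δ-resp
  (λ e → ≈⁅⁆⇔ ⁅ τ e , τ e ⁆ ⁅ τ e , υ e ⁆ (π e))
  (Δ-resp (λ e → ∃≈⇔∈ ⁅ τ e , τ e ⁆ (π e)) (∃∈ᵈ p (≈⁅⁆ᵈ new (wk x) (wk x))) ∧ᵈ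
   Δ-resp (λ e → ∃≈⇔∈ ⁅ τ e , υ e ⁆ (π e)) (∃∈ᵈ p (≈⁅⁆ᵈ new (wk x) (wk y))) ∧ᵈ
   ∀∈ᵈ p (≈⁅⁆ᵈ new (wk x) (wk x) ∨ᵈ ≈⁅⁆ᵈ new (wk x) (wk y)))

-- The code of the tail is an element of an element of the pair, so it can be introduced by two
-- bounded quantifiers.
≈codeᵈ : ∀ {E : Set₁} {m k} {v : E → Vector V m} {π} {τ : E → Vector V (suc k)} →
  Var v π → (∀ i → Var v (λ e → τ e i)) → Definable v (λ e → π e ≈ code (τ e))
≈codeᵈ {k = zero}  p us = p ≈ᵈ us zero
≈codeᵈ {k = suc k} {π = π} {τ} p us = Δ-resp
  (λ e → mk⇔
    (λ (_ , _ , h , h′) → ≈-trans {π e} {pair (τ e zero) _} {code (τ e)}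
       h (pair-cong (≈-refl (τ e zero)) h′))
    (λ h →
      let a = τ e zero ; c = code (τ e ∘ suc)
          i , q  = ≈⇒⊆ (pair a c) (π e) (≈-sym {π e} {pair a c} h) false
          j , q′ = ≈⇒⊆ ⁅ a , c ⁆ (el (π e) i) q false
      in i , j , ≈-trans {π e} {pair a c} {pair a (el (el (π e) i) j)} h
                   (pair-cong (≈-refl a) q′) , ≈-sym q′))
  (∃∈ᵈ p (∃∈ᵈ new
    (≈pairᵈ (wk (wk p)) (wk (wk (us zero))) new ∧ᵈ
     ≈codeᵈ {τ = λ e i → τ (proj₁ (proj₁ e)) (suc i)} new (λ i → wk (wk (us (suc i)))))))

code∈ᵈ : ∀ {E : Set₁} {m k} {v : E → Vector V m} {π} {τ : E → Vector V (suc k)} →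
  (∀ i → Var v (λ e → τ e i)) → Var v π → Definable v (λ e → code (τ e) ∈ π e)
code∈ᵈ {π = π} {τ} us p = Δ-resp (λ e → ∃≈⇔∈ (code (τ e)) (π e))
  (∃∈ᵈ p (≈codeᵈ {τ = τ ∘ proj₁} new (λ i → wk (us i))))

module _ {E : Set₁} {m} {v : E → Vector V m} where

  Ordinalᵈ : ∀ {τ} → Var v τ → Definable v (λ e → Ordinal (τ e))
  Ordinalᵈ x = Transitiveᵈ x ∧ᵈ ∀∈ᵈ x (Transitiveᵈ new)

  Limitᵈ : ∀ {τ} → Var v τ → Definable v (λ e → Limit (τ e))
  Limitᵈ {τ} x = Δ-resp
    (λ e → mk⇔
      (λ ((i , _) , h) → i , λ j → to (∃≈⇔∈ (succ (el (τ e) j)) (τ e)) (h j))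
      (λ (i , h) → (i , ≈-refl _) , λ j → from (∃≈⇔∈ (succ (el (τ e) j)) (τ e)) (h j)))
    (∃∈ᵈ x (new ≈ᵈ new) ∧ᵈ ∀∈ᵈ x (∃∈ᵈ (wk x) (≈succᵈ new (wk new))))

-- The constructible hierarchy

separate-⊆ : ∀ x (Q : Index x → Set) → separate x Q ⊆ x
separate-⊆ x Q (i , _) = i , ≈-refl (el x i)

separate-cong : ∀ x {Q Q′ : Index x → Set} → (∀ i → Q i ⇔ Q′ i) →
  separate x Q ≈ separate x Q′
separate-cong x h =
  (λ (i , q) → (i , to (h i) q) , ≈-refl (el x i)) ,
  (λ (i , q) → (i , from (h i) q) , ≈-refl (el x i))

-- Δ₀ separation: as x is transitive, the formula means the same over x as in V, so it defines the
-- subset over x.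
separate-∈ : ∀ {E : Set₁} {m} {v : E → Vector V m} {P} → Definable (v ▸) P →
  ∀ x → Transitive x → ∀ e → (∀ i → v e i ∈ x) →
  separate x (λ i → P (e , el x i)) ∈ Def x
separate-∈ {m = m} {v} {P} (definable {φ} d c) x t e h =
  (m , φ , proj₁ ∘ h) , separate-cong x λ i → mk⇔
    (λ p → from (absolute i) (from (c (e , el x i)) p))
    (λ s → to (c (e , el x i)) (to (absolute i) s))
  where
  absolute : ∀ i → Sat (el x) φ (i ∷ proj₁ ∘ h) ⇔ Holds d (el x i ∷ v e)
  absolute i = Δ₀-absolute (el x) (λ i j → let k , q = t i j in k , ≈-sym q) d _ _
    λ { zero → ≈-refl (el x i) ; (suc j) → ≈-sym (proj₂ (h j)) }

⊆-Def : ∀ x → Transitive x → x ⊆ Def x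
⊆-Def x t i = ∈-respˡ (Def x)
  (⊆-antisym s (el x i)
    (λ (_ , m) → m)
    (λ j → let k , p = t i j
           in (k , ∈-respˡ (el x i) p (el-∈ (el x i) j)) , p))
  (separate-∈ {v = λ y → y ∷ []} (new ∈ᵈ wk (var zero λ _ → refl)) x t (el x i)
    λ { zero → el-∈ x i })
  where
  s : V
  s = separate x (λ k → el x k ∈ el x i)

self-∈-Def : ∀ x → Transitive x → x ∈ Def x
self-∈-Def x t = ∈-respˡ (Def x)
  (⊆-antisym (separate x (λ i → el x i ≈ el x i)) x
    (separate-⊆ x (λ i → el x i ≈ el x i))
    (λ i → (i , ≈-refl (el x i)) , ≈-refl (el x i)))
  (separate-∈ {E = V} {v = λ _ → []} (new ≈ᵈ new) x t x λ ())

Def-⊆-L : ∀ γ i → Def (L (el γ i)) ⊆ L γ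
Def-⊆-L (sup A f) a d = (a , d) , ≈-refl _

-- A definable subset of `L (f a)` has its elements in `L (f a)`, which by induction is transitive
-- and hence included in `Def (L (f a))`.
L-transitive : ∀ γ → Transitive (L γ)
L-transitive (sup A f) (a , d) (j , _) =
  ∈-⊆ (Def (L (f a))) (L (sup A f)) (⊆-Def (L (f a)) (L-transitive (f a)) j)
    (Def-⊆-L (sup A f) a)

L-⊆ : ∀ γ i → L (el γ i) ⊆ L γ
L-⊆ γ i = ⊆-trans (L (el γ i)) (Def (L (el γ i))) (L γ)
  (⊆-Def (L (el γ i)) (L-transitive (el γ i))) (Def-⊆-L γ i)

∈-L-lub : ∀ {A : Set} (f : A → V) a {x} → x ∈ L (f a) → x ∈ L (lub A f)
∈-L-lub f a m = ∈-⊆ (L (f a)) (L (lub _ f)) m (L-⊆ (lub _ f) (a , nothing))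

∈-Def-L : ∀ γ {x} → x ∈ Def (L γ) → x ∈ L (succ γ)
∈-Def-L γ m = ∈-⊆ (Def (L γ)) (L (succ γ)) m (Def-⊆-L (succ γ) nothing)

∈-L-succ : ∀ γ {x} → x ∈ L γ → x ∈ L (succ γ)
∈-L-succ γ m = ∈-⊆ (L γ) (L (succ γ)) m (L-⊆ (succ γ) nothing)

L-∈-L : ∀ γ → L γ ∈ L (succ γ)
L-∈-L γ = ∈-Def-L γ (self-∈-Def (L γ) (L-transitive γ))

-- Replacement is borrowed from the metatheory: the levels are indexed by a small type, so they have
-- a `lub` even if the family is not definable in L.
constructible-bound : ∀ {A : Set} (xs : A → V) → (∀ a → Constructible (xs a)) →
  Σ[ γ ∈ V ] Ordinal γ × (∀ a → xs a ∈ L γ)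
constructible-bound xs h =
  lub _ (proj₁ ∘ h) , Ordinal-lub (proj₁ ∘ h) (proj₁ ∘ proj₂ ∘ h) ,
  λ a → ∈-L-lub (proj₁ ∘ h) a (proj₂ (proj₂ (h a)))

⁅⁆-constructible : ∀ x y → Constructible x → Constructible y → Constructible ⁅ x , y ⁆
⁅⁆-constructible x y p q
  with constructible-bound (el ⁅ x , y ⁆) (λ { true → p ; false → q })
... | η , oη , ∈L =
  succ η , Ordinal-succ η oη ,
  ∈-Def-L η (∈-respˡ (Def (L η))
    (to (≈⁅⁆⇔ x y _)
      ((let i , e = ∈L true in (i , inj₁ (≈-sym e)) , e) ,
       (let i , e = ∈L false in (i , inj₂ (≈-sym e)) , e) ,
       proj₂))
    (separate-∈ {v = λ (x , y) → x ∷ y ∷ []}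
      (new ≈ᵈ wk (var zero λ _ → refl) ∨ᵈ new ≈ᵈ wk (var (suc zero) λ _ → refl))
      (L η) (L-transitive η) (x , y)
      λ { zero → ∈L true ; (suc zero) → ∈L false }))

pair-constructible : ∀ x y → Constructible x → Constructible y → Constructible (pair x y)
pair-constructible x y p q =
  ⁅⁆-constructible ⁅ x , x ⁆ ⁅ x , y ⁆ (⁅⁆-constructible x x p p) (⁅⁆-constructible x y p q)

code-constructible : ∀ {k} (us : Vector V (suc k)) →
  (∀ i → Constructible (us i)) → Constructible (code us)
code-constructible {zero}  us h = h zero
code-constructible {suc k} us h =
  pair-constructible (us zero) _ (h zero) (code-constructible (us ∘ suc) (h ∘ suc))

module OrdinalsInL (em : ExcludedMiddle 0ℓ) where
  open Classical em

  -- Otherwise x includes γ and so contains `f a`, where a is the stage that introduces x as a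
  -- subset of `L (f a)`. Then `f a ∈ L (f a)`, which by induction gives `f a ∈ f a`.
  Ordinal-∈-L : ∀ γ x → Ordinal γ → Ordinal x → x ∈ L γ → x ∈ γ
  Ordinal-∈-L γ@(sup A f) x oγ ox ((a , d) , e) with trichotomy x γ ox oγ
  ... | inj₁ m        = m
  ... | inj₂ h = ⊥-elim (∈-irrefl (f a)
      (Ordinal-∈-L (f a) (f a) ofa ofa
        (∈-⊆ (el (L γ) (a , d)) (L (f a))
          (∈-respʳ x (el (L γ) (a , d)) e (fa∈x h))
          (separate-⊆ (L (f a)) _))))
    where
    ofa : Ordinal (f a)
    ofa = Ordinal-∈ (f a) γ oγ (el-∈ γ a)

    fa∈x : x ≈ γ ⊎ γ ∈ x → f a ∈ x
    fa∈x (inj₁ e) = ∈-respʳ γ x (≈-sym e) (el-∈ γ a)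
    fa∈x (inj₂ m) = ∈-trans γ x (proj₁ ox) (el-∈ γ a) m

  -- Proved together with `Ordinal-∈-Def`: over `L γ`, the Δ₀ property of being an ordinal defines
  -- exactly γ.
  Ordinal-⊆-L : ∀ γ → Ordinal γ → γ ⊆ L γ
  Ordinal-∈-Def : ∀ γ → Ordinal γ → γ ∈ Def (L γ)

  Ordinal-⊆-L γ@(sup A f) o a =
    ∈-⊆ (Def (L (f a))) (L γ)
      (Ordinal-∈-Def (f a) (Ordinal-∈ (f a) γ o (el-∈ γ a))) (Def-⊆-L γ a)

  Ordinal-∈-Def γ@(sup _ _) o = ∈-respˡ (Def (L γ))
    (⊆-antisym (separate (L γ) λ i → Ordinal (el (L γ) i)) γ
      (λ (i , oi) → Ordinal-∈-L γ (el (L γ) i) o oi (el-∈ (L γ) i))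
      (λ a → let i , e = Ordinal-⊆-L γ o a
             in (i , Ordinal-∈ (el (L γ) i) γ o (a , ≈-sym e)) , e))
    (separate-∈ {E = V} {v = λ _ → []} (Ordinalᵈ new) (L γ) (L-transitive γ) γ λ ())

  Ordinal-∈-L-succ : ∀ γ → Ordinal γ → γ ∈ L (succ γ)
  Ordinal-∈-L-succ γ o = ∈-Def-L γ (Ordinal-∈-Def γ o)

  Ordinal-constructible : ∀ γ → Ordinal γ → Constructible γ
  Ordinal-constructible γ o = succ γ , Ordinal-succ γ o , Ordinal-∈-L-succ γ o

-- Register machines

updateAt-≋ : ∀ {n} {r q : Vector V n} i {f g : V → V} →
  r ≋ q → f (r i) ≈ g (q i) → updateAt r i f ≋ updateAt q i g
updateAt-≋ zero    h e zero    = e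
updateAt-≋ zero    h e (suc j) = h (suc j)
updateAt-≋ (suc i) h e zero    = h zero
updateAt-≋ (suc i) h e (suc j) = updateAt-≋ i (h ∘ suc) e j

≋-sym : ∀ {n} {r q : Vector V n} → r ≋ q → q ≋ r
≋-sym h i = ≈-sym (h i)

≋-trans : ∀ {n} {r q p : Vector V n} → r ≋ q → q ≋ p → r ≋ p
≋-trans h k i = ≈-trans (h i) (k i)

Execute-resp : ∀ {n} x (c : Command n) {l l′ r r′ q q′} →
  r ≋ q → r′ ≋ q′ → Execute x c ⟨ l , r ⟩ ⟨ l′ , r′ ⟩ → Execute x c ⟨ l , q ⟩ ⟨ l′ , q′ ⟩
Execute-resp x (increment i) h h′ (p , e) =
  p , ≋-trans (≋-sym h′) (≋-trans e (updateAt-≋ i h (succ-cong _ _ (h i))))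
Execute-resp x (copy i j) h h′ (p , e) =
  p , ≋-trans (≋-sym h′) (≋-trans e (updateAt-≋ j h (h i)))
Execute-resp x (jump i j m) h h′ (inj₁ (s , p) , e) =
  inj₁ (≈-trans (≈-sym (h i)) (≈-trans s (h j)) , p) ,
  ≋-trans (≋-sym h′) (≋-trans e h)
Execute-resp x (jump i j m) h h′ (inj₂ (s , p) , e) =
  inj₂ ((λ s′ → s (≈-trans (h i) (≈-trans s′ (≈-sym (h j))))) , p) ,
  ≋-trans (≋-sym h′) (≋-trans e h)
Execute-resp x (oracle j) h h′ (p , inj₁ (m , e)) =
  p , inj₁ (∈-respˡ x (h j) m ,
            ≋-trans (≋-sym h′) (≋-trans e (updateAt-≋ j h (≈-refl one))))
Execute-resp x (oracle j) h h′ (p , inj₂ (m , e)) =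
  p , inj₂ (m ∘ ∈-respˡ x (≈-sym (h j)) ,
            ≋-trans (≋-sym h′) (≋-trans e (updateAt-≋ j h (≈-refl ∅))))

-- An oracle is only consulted at the content of a register, so agreement there is enough.
Execute-deterministic : ∀ {n} x y (c : Command n) {l l₁ l₂ r r₁ r₂} →
  (∀ i → r i ∈ x ⇔ r i ∈ y) →
  Execute x c ⟨ l , r ⟩ ⟨ l₁ , r₁ ⟩ → Execute y c ⟨ l , r ⟩ ⟨ l₂ , r₂ ⟩ →
  l₁ ≡ l₂ × r₁ ≋ r₂
Execute-deterministic x y (increment i) h (refl , e) (refl , e′) =
  refl , ≋-trans e (≋-sym e′)
Execute-deterministic x y (copy i j) h (refl , e) (refl , e′) =
  refl , ≋-trans e (≋-sym e′)
Execute-deterministic x y (jump i j m) h (inj₁ (_ , refl) , e) (inj₁ (_ , refl) , e′) =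
  refl , ≋-trans e (≋-sym e′)
Execute-deterministic x y (jump i j m) h (inj₂ (_ , refl) , e) (inj₂ (_ , refl) , e′) =
  refl , ≋-trans e (≋-sym e′)
Execute-deterministic x y (jump i j m) h (inj₁ (s , _) , _) (inj₂ (s′ , _) , _) =
  ⊥-elim (s′ s)
Execute-deterministic x y (jump i j m) h (inj₂ (s , _) , _) (inj₁ (s′ , _) , _) =
  ⊥-elim (s s′)
Execute-deterministic x y (oracle j) h (refl , inj₁ (_ , e)) (refl , inj₁ (_ , e′)) =
  refl , ≋-trans e (≋-sym e′)
Execute-deterministic x y (oracle j) h (refl , inj₂ (_ , e)) (refl , inj₂ (_ , e′)) =
  refl , ≋-trans e (≋-sym e′)
Execute-deterministic x y (oracle j) h (_ , inj₁ (m , _)) (_ , inj₂ (m′ , _)) =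
  ⊥-elim (m′ (to (h j) m))
Execute-deterministic x y (oracle j) h (_ , inj₂ (m , _)) (_ , inj₁ (m′ , _)) =
  ⊥-elim (m (from (h j) m′))

-- The time s is itself one of the r, which yields the membership in `u (el t s)` built into the
-- index of `liminf`.
∈-liminf : ∀ t u {z} →
  z ∈ liminf t u ⇔ (∃[ s ] ∀ r → el t s ⊆ el t r → z ∈ u (el t r))
∈-liminf t u = mk⇔
  (λ ((s , z , h) , e) → s , λ r p → ∈-respˡ (u (el t r)) (≈-sym e) (h r p))
  (λ (s , h) → let i , e = h s (el-∈ (el t s))
               in (s , i , λ r p → ∈-respˡ (u (el t r)) e (h r p)) , e)

-- Descriptions of runs by sets of snapshots

module Snapshots {k} (P : Program (suc k)) where

  -- A snapshot lists the time, the active line and the register contents.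
  Snapshot : Set₁
  Snapshot = Vector V (3 ℕ.+ k)

  time activeLine : Snapshot → V
  time s       = s zero
  activeLine s = s (suc zero)

  regs : Snapshot → Vector V (suc k)
  regs s i = s (suc (suc i))

  initial : V → Vector V (suc k)
  initial ξ = (ξ ∷ []) ++ replicate k ∅

  -- The components of snapshots are drawn from B, so that quantifying over
  -- snapshots is a bounded quantification.
  SnapshotAt : (F B t : V) → (Snapshot → Set) → Set
  SnapshotAt F B t Q = Σ[ is ∈ (Fin (3 ℕ.+ k) → Index B) ]
    time (el B ∘ is) ≈ t × code (el B ∘ is) ∈ F × Q (el B ∘ is)

  Successor : V → Snapshot → Snapshot → Set
  Successor y u s = ∃[ l ] ∃[ l′ ]
    activeLine u ≈ fromℕ (toℕ l) × activeLine s ≈ fromℕ l′ ×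
    Execute y (lookup P l) ⟨ toℕ l , regs u ⟩ ⟨ l′ , regs s ⟩

  Start : V → Snapshot → Set
  Start ξ s = time s ≈ ∅ × activeLine s ≈ ∅ × regs s ≋ initial ξ

  AfterStep : (F B y : V) → Snapshot → Set
  AfterStep F B y s = Σ[ is ∈ (Fin (3 ℕ.+ k) → Index B) ]
    time s ≈ succ (time (el B ∘ is)) × code (el B ∘ is) ∈ F ×
    Successor y (el B ∘ is) s

  OmittedAfter : (F B t : V) → Index t → Fin (2 ℕ.+ k) → V → Set
  OmittedAfter F B t a j x = ∃[ r ] el t a ⊆ el t r ×
    SnapshotAt F B (el t r) λ u → x ∉ u (suc j)

  -- The second half of the inferior limit condition is contraposed: this
  -- keeps F in positive positions, so that being justified is monotone in F.
  AtLimit : (F B : V) → Snapshot → Set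
  AtLimit F B s =
    Transitive (time s) × Limit (time s) × ∀ (j : Fin (2 ℕ.+ k)) →
    (∀ z → ∃[ a ] ∀ r → el (time s) a ⊆ el (time s) r →
       SnapshotAt F B (el (time s) r) λ u → el (s (suc j)) z ∈ u (suc j)) ×
    (∀ a → SnapshotAt F B (el (time s) a) λ u → ∀ z →
       el (u (suc j)) z ∈ s (suc j) ⊎
       OmittedAfter F B (time s) a j (el (u (suc j)) z))

  Justified : (F B y γ ξ : V) → Snapshot → Set
  Justified F B y γ ξ s =
    (∀ i → regs s i ∈ γ) × (Start ξ s ⊎ AfterStep F B y s ⊎ AtLimit F B s)

  -- Elements of F that code no tuple from B are ignored, and several snapshots may share a time.
  -- That they agree with a given run is left to an induction on time.
  Coherent : (F B y γ ξ : V) → Set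
  Coherent F B y γ ξ = ∀ (is : Fin (3 ℕ.+ k) → Index B) →
    code (el B ∘ is) ∈ F → Justified F B y γ ξ (el B ∘ is)

  SnapshotAt-map : ∀ F G B t {Q R : Snapshot → Set} → F ⊆ G → (∀ u → Q u → R u) →
    SnapshotAt F B t Q → SnapshotAt G B t R
  SnapshotAt-map F G B t p h (is , e , m , q) = is , e , ∈-⊆ F G m p , h _ q

  -- This makes unions of coherent sets coherent: each snapshot keeps the justification it had in
  -- one of them.
  Justified-mono : ∀ F G B y γ ξ s → F ⊆ G →
    Justified F B y γ ξ s → Justified G B y γ ξ s
  Justified-mono F G B y γ ξ s p (b , inj₁ h) = b , inj₁ h
  Justified-mono F G B y γ ξ s p (b , inj₂ (inj₁ (is , e , m , h))) =
    b , inj₂ (inj₁ (is , e , ∈-⊆ F G m p , h))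
  Justified-mono F G B y γ ξ s p (b , inj₂ (inj₂ (t , l , h))) =
    b , inj₂ (inj₂ (t , l , λ j →
      (λ z → let a , h′ = proj₁ (h j) z
             in a , λ r q → mono _ (λ u → el (s (suc j)) z ∈ u (suc j)) (h′ r q)) ,
      (λ a → SnapshotAt-map F G B (el (time s) a)
        {λ u → ∀ z → el (u (suc j)) z ∈ s (suc j) ⊎
                     OmittedAfter F B (time s) a j (el (u (suc j)) z)}
        p (λ u h′ z → Sum.map id
          (λ (r , q , m) → r , q , mono _ (λ u′ → el (u (suc j)) z ∉ u′ (suc j)) m)
          (h′ z))
        (proj₂ (h j) a))))
    where
    mono : ∀ t Q → SnapshotAt F B t Q → SnapshotAt G B t Q
    mono t Q = SnapshotAt-map F G B t {Q} p (λ _ q → q)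

  Accepts : (F B : V) → Set
  Accepts F B = Σ[ is ∈ (Fin (3 ℕ.+ k) → Index B) ]
    code (el B ∘ is) ∈ F ×
    (∀ (l : Fin (length P)) → ¬ activeLine (el B ∘ is) ≈ fromℕ (toℕ l)) ×
    regs (el B ∘ is) zero ≈ one

  AcceptingRun : (F B y γ ξ : V) → Set
  AcceptingRun F B y γ ξ =
    Ordinal γ × y ⊆ γ × Coherent F B y γ ξ × Accepts F B

  -- Δ₀ definitions of the descriptions

  updateAtᵈ : ∀ {E : Set₁} {m n} {v : E → Vector V m} {τ : E → V}
    {r : E → Vector V n} {f : E → V → V} i j →
    Definable v (λ e → τ e ≈ f e (r e i)) → Definable v (λ e → τ e ≈ r e j) →
    Definable v (λ e → τ e ≈ updateAt (r e) i (f e) j)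
  updateAtᵈ zero    zero    p q = p
  updateAtᵈ zero    (suc j) p q = q
  updateAtᵈ (suc i) zero    p q = q
  updateAtᵈ {r = r} (suc i) (suc j) p q = updateAtᵈ {r = λ e → r e ∘ suc} i j p q

  module _ {E : Set₁} {m} {v : E → Vector V m} where

    -- The command and l leave at most two candidates for `l′`, so the quantifier over numbers
    -- disappears and no arithmetic has to be formalized.
    Executeᵈ : ∀ {y : E → V} {u s : E → Snapshot} (c : Command (suc k)) l →
      Var v y → (∀ i → Var v (λ e → u e i)) → (∀ i → Var v (λ e → s e i)) →
      Definable v (λ e → ∃[ l′ ]
        activeLine (u e) ≈ fromℕ l × activeLine (s e) ≈ fromℕ l′ ×
        Execute (y e) c ⟨ l , regs (u e) ⟩ ⟨ l′ , regs (s e) ⟩)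
    Executeᵈ {u = u} (increment i) l y us ss = Δ-resp
      (λ e → mk⇔ (λ (p , q , h) → _ , p , q , refl , h)
                 (λ { (_ , p , q , refl , h) → p , q , h }))
      (≈fromℕᵈ l (us (suc zero)) ∧ᵈ ≈fromℕᵈ (suc l) (ss (suc zero)) ∧ᵈ
       ∀ᶠᵈ y λ j → updateAtᵈ {r = regs ∘ u} i j
         (≈succᵈ (ss (suc (suc j))) (us (suc (suc i))))
         (ss (suc (suc j)) ≈ᵈ us (suc (suc j))))
    Executeᵈ {u = u} (copy i i′) l y us ss = Δ-resp
      (λ e → mk⇔ (λ (p , q , h) → _ , p , q , refl , h)
                 (λ { (_ , p , q , refl , h) → p , q , h }))
      (≈fromℕᵈ l (us (suc zero)) ∧ᵈ ≈fromℕᵈ (suc l) (ss (suc zero)) ∧ᵈ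
       ∀ᶠᵈ y λ j → updateAtᵈ {r = regs ∘ u} {f = λ e → const (regs (u e) i)} i′ j
         (ss (suc (suc j)) ≈ᵈ us (suc (suc i)))
         (ss (suc (suc j)) ≈ᵈ us (suc (suc j))))
    Executeᵈ {u = u} (jump i i′ d) l y us ss = Δ-resp
      (λ e → mk⇔
        (λ { (p , inj₁ (s , q) , h) → _ , p , q , inj₁ (s , refl) , h
           ; (p , inj₂ (s , q) , h) → _ , p , q , inj₂ (s , refl) , h })
        (λ { (_ , p , q , inj₁ (s , refl) , h) → p , inj₁ (s , q) , h
           ; (_ , p , q , inj₂ (s , refl) , h) → p , inj₂ (s , q) , h }))
      (≈fromℕᵈ l (us (suc zero)) ∧ᵈ
       (us (suc (suc i)) ≈ᵈ us (suc (suc i′)) ∧ᵈ ≈fromℕᵈ d (ss (suc zero)) ∨ᵈ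
        ¬ᵈ (us (suc (suc i)) ≈ᵈ us (suc (suc i′))) ∧ᵈ ≈fromℕᵈ (suc l) (ss (suc zero))) ∧ᵈ
       ∀ᶠᵈ y λ j → ss (suc (suc j)) ≈ᵈ us (suc (suc j)))
    Executeᵈ {u = u} {s} (oracle i) l y us ss = Δ-resp
      (λ e → mk⇔ (λ (p , q , h) → _ , p , q , refl , h)
                 (λ { (_ , p , q , refl , h) → p , q , h }))
      (≈fromℕᵈ l (us (suc zero)) ∧ᵈ ≈fromℕᵈ (suc l) (ss (suc zero)) ∧ᵈ
       (us (suc (suc i)) ∈ᵈ y ∧ᵈ updatedᵈ 1 ∨ᵈ ¬ᵈ (us (suc (suc i)) ∈ᵈ y) ∧ᵈ updatedᵈ 0))
      where
      updatedᵈ : ∀ c → Definable v (λ e → regs (s e) ≋ updateAt (regs (u e)) i (const (fromℕ c)))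
      updatedᵈ c = ∀ᶠᵈ y λ j → updateAtᵈ {r = regs ∘ u} {f = λ _ → const (fromℕ c)} i j
        (≈fromℕᵈ c (ss (suc (suc j)))) (ss (suc (suc j)) ≈ᵈ us (suc (suc j)))

    Startᵈ : ∀ {ξ : E → V} {s : E → Snapshot} →
      Var v ξ → (∀ i → Var v (λ e → s e i)) → Definable v (λ e → Start (ξ e) (s e))
    Startᵈ {ξ} {s} x ss = ≈∅ᵈ (ss zero) ∧ᵈ ≈∅ᵈ (ss (suc zero)) ∧ᵈ ∀ᶠᵈ x initialᵈ
      where
      initialᵈ : ∀ i → Definable v (λ e → regs (s e) i ≈ initial (ξ e) i)
      initialᵈ zero    = ss (suc (suc zero)) ≈ᵈ x
      initialᵈ (suc i) = ≈∅ᵈ (ss (suc (suc (suc i))))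

    SnapshotAtᵈ : ∀ {F B t : E → V} {Q : E × Snapshot → Set} →
      Var v F → Var v B → Var v t → Definable (v ▸^ (3 ℕ.+ k)) Q →
      Definable v (λ e → SnapshotAt (F e) (B e) (t e) λ u → Q (e , u))
    SnapshotAtᵈ f b t q =
      ∃^ᵈ b (new^ zero ≈ᵈ wk^ t ∧ᵈ code∈ᵈ {τ = proj₂} new^ (wk^ f) ∧ᵈ q)

module _ {k} (P : Program (suc k)) (em : ExcludedMiddle 0ℓ) where
  open Snapshots P

  module _ {E : Set₁} {m} {v : E → Vector V m} {F B : E → V}
           (f : Var v F) (b : Var v B) where

    AfterStepᵈ : ∀ {y : E → V} {s : E → Snapshot} → Var v y → (∀ i → Var v (λ e → s e i)) →
      Definable v (λ e → AfterStep (F e) (B e) (y e) (s e))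
    AfterStepᵈ {s = s} o ss = ∃^ᵈ b
      (≈succᵈ (wk^ (ss zero)) (new^ zero) ∧ᵈ code∈ᵈ {τ = proj₂} new^ (wk^ f) ∧ᵈ
       ∃ᶠᵈ (wk^ b) λ l → Executeᵈ {u = proj₂} {s ∘ proj₁} (lookup P l) (toℕ l)
         (wk^ o) new^ (wk^ ∘ ss))

    AtLimitᵈ : ∀ {s : E → Snapshot} → (∀ i → Var v (λ e → s e i)) →
      Definable v (λ e → AtLimit (F e) (B e) (s e))
    AtLimitᵈ {s} ss = Transitiveᵈ (ss zero) ∧ᵈ Limitᵈ (ss zero) ∧ᵈ ∀ᶠᵈ b λ j →
      ∀∈ᵈ (ss (suc j)) (∃∈ᵈ (wk (ss zero)) (∀∈ᵈ (wk (wk (ss zero)))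
        (wk new ⊆ᵈ new ⇒ᵈ
         SnapshotAtᵈ (wk (wk (wk f))) (wk (wk (wk b))) new
           (wk^ (wk (wk new)) ∈ᵈ new^ (suc j))))) ∧ᵈ
      ∀∈ᵈ (ss zero) (SnapshotAtᵈ (wk f) (wk b) new
        (∀∈ᵈ (new^ (suc j))
          (new ∈ᵈ wk (wk^ (wk (ss (suc j)))) ∨ᵈ
           ∃∈ᵈ (wk (wk^ (wk (ss zero))))
             (wk (wk (wk^ new)) ⊆ᵈ new ∧ᵈ
              SnapshotAtᵈ (wk (wk (wk^ (wk f)))) (wk (wk (wk^ (wk b)))) new
                (¬ᵈ (wk^ (wk new) ∈ᵈ new^ (suc j)))))))

  module _ {E : Set₁} {m} {v : E → Vector V m} {F B y γ ξ : E → V}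
           (f : Var v F) (b : Var v B) (o : Var v y) (g : Var v γ) (x : Var v ξ) where

    Coherentᵈ : Definable v (λ e → Coherent (F e) (B e) (y e) (γ e) (ξ e))
    Coherentᵈ = ∀^ᵈ em b (code∈ᵈ {τ = proj₂} new^ (wk^ f) ⇒ᵈ
      ∀ᶠᵈ (wk^ b) (λ i → new^ (suc (suc i)) ∈ᵈ wk^ g) ∧ᵈ
      (Startᵈ {s = proj₂} (wk^ x) new^ ∨ᵈ
       AfterStepᵈ (wk^ f) (wk^ b) {s = proj₂} (wk^ o) new^ ∨ᵈ
       AtLimitᵈ (wk^ f) (wk^ b) {s = proj₂} new^))

    AcceptingRunᵈ : Definable v (λ e → AcceptingRun (F e) (B e) (y e) (γ e) (ξ e))
    AcceptingRunᵈ = Ordinalᵈ g ∧ᵈ o ⊆ᵈ g ∧ᵈ Coherentᵈ ∧ᵈ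
      ∃^ᵈ b (code∈ᵈ {τ = proj₂} new^ (wk^ f) ∧ᵈ
        ∀ᶠᵈ (wk^ b) (λ l → ¬ᵈ ≈fromℕᵈ (toℕ l) (new^ (suc zero))) ∧ᵈ
        ≈fromℕᵈ 1 (new^ (suc (suc zero))))

-- Comparison of descriptions with a given halting run

Step⇒Execute : ∀ {n} (P : Program n) x c c′ (l : Fin (length P)) → toℕ l ≡ line c →
  Step P x c c′ → Execute x (lookup P l) ⟨ toℕ l , registers c ⟩ c′
Step⇒Execute P x c@(⟨ _ , r ⟩) c′ l refl (active , e) =
  subst (λ i → Execute x (lookup P i) c c′) (fromℕ<-toℕ l active) e

-- With the line index in front of the registers, the two inferior limit rules become one.
contents : ∀ {n} → Config n → Vector V (suc n)
contents c = fromℕ (line c) ∷ registers c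

module _ (em : ExcludedMiddle 0ℓ) {k} (P : Program (suc k)) where
  open Classical em
  open OrdinalsInL em
  open Snapshots P

  module HaltingRun (α x ξ θ : V) (C : V → Config (suc k)) (oθ : Ordinal θ)
                    (run : Run α P x (initial ξ) θ C)
                    (halted : length P ℕ.≤ line (C θ)) where
    open Run run

    contents-cong : ∀ s t → s ∈ succ θ → s ≈ t → contents (C s) ≋ contents (C t)
    contents-cong s t m e zero    = ≈-reflexive (cong fromℕ (line-cong {s} {t} m e))
    contents-cong s t m e (suc i) = registers-cong {s} {t} m e i

    limit-contents : ∀ t → t ∈ succ θ → Limit t → ∀ j →
      contents (C t) j ≈ liminf t (λ r → contents (C r) j)
    limit-contents t m l zero    = limit-line {t} m l
    limit-contents t m l (suc i) = limit-registers {t} m l i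

    Matches : V → Snapshot → Set
    Matches t u = ∀ j → u (suc j) ≈ contents (C t) j

    ∈-liminf-contents : ∀ t → t ∈ succ θ → Limit t → ∀ j {z} →
      z ∈ contents (C t) j ⇔
      (∃[ s ] ∀ r → el t s ⊆ el t r → z ∈ contents (C (el t r)) j)
    ∈-liminf-contents t m l j = mk⇔
      (λ h → to (∈-liminf t u) (∈-respʳ (contents (C t) j) (liminf t u) e h))
      (λ h → ∈-respʳ (liminf t u) (contents (C t) j)
        (≈-sym {contents (C t) j} {liminf t u} e) (from (∈-liminf t u) h))
      where
      u : V → V
      u r = contents (C r) j
      e : contents (C t) j ≈ liminf t u
      e = limit-contents t m l j

    -- Soundness: coherent sets record only configurations of the run

    module Soundness (F B y γ : V) (coherent : Coherent F B y γ ξ)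
                     (agree : ∀ z → z ∈ γ → z ∈ y ⇔ z ∈ x) where

      Correct : Snapshot → Set
      Correct s = time s ∈ succ θ × Matches (time s) s

      Earlier : Snapshot → Set
      Earlier s = ∀ (is : Fin (3 ℕ.+ k) → Index B) → time (el B ∘ is) ∈ time s →
        code (el B ∘ is) ∈ F → Correct (el B ∘ is)

      start-correct : ∀ s → Start ξ s → Correct s
      start-correct s (p , q , r) = ∈-respˡ (succ θ) (≈-sym {time s} {∅} p) ∅∈ , λ
        { zero → ≈-trans {activeLine s} {∅} q
            (≈-reflexive (cong fromℕ (trans (sym start-line) line≡)))
        ; (suc i) → ≈-trans (r i) (≈-trans (≈-sym (start-registers i))
            (registers-cong {∅} {time s} ∅∈ (≈-sym {time s} {∅} p) i)) }
        where
        ∅∈ : ∅ ∈ succ θ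
        ∅∈ = ⊆⇒∈-succ ∅ θ Ordinal-∅ oθ (∅-⊆ θ)
        line≡ : line (C ∅) ≡ line (C (time s))
        line≡ = line-cong {∅} {time s} ∅∈ (≈-sym {time s} {∅} p)

      -- At θ the line index is past the end of the program. Hence a description cannot continue the
      -- run beyond θ by an `AfterStep`.
      active⇒∈θ : ∀ s (l : Fin (length P)) → Correct s →
        activeLine s ≈ fromℕ (toℕ l) → toℕ l ≡ line (C (time s)) × time s ∈ θ
      active⇒∈θ s l (m , h) e = l≡ , Sum.[ id , (λ p → ⊥-elim (<⇒≱ (toℕ<n l)
          (subst (length P ℕ.≤_) (sym (trans l≡ (line-cong {time s} {θ} m p))) halted))) ]′
          (∈-succ⁻ θ m)
        where
        l≡ : toℕ l ≡ line (C (time s))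
        l≡ = fromℕ-injective _ _ (≈-trans (≈-sym e) (h zero))

      step-correct : ∀ s → Earlier s → AfterStep F B y s → Correct s
      step-correct s ih (is , e , m , l , l′ , p , q , exec) =
        ∈-respˡ (succ θ) s≈ succ∈ , λ
          { zero → ≈-trans q (≈-trans (≈-reflexive (cong fromℕ (proj₁ det)))
                     (contents-cong (succ t) (time s) succ∈ s≈ zero))
          ; (suc i) → ≈-trans (proj₂ det i)
                        (contents-cong (succ t) (time s) succ∈ s≈ (suc i)) }
        where
        u : Snapshot
        u = el B ∘ is
        t : V
        t = time u
        s≈ : succ t ≈ time s
        s≈ = ≈-sym {time s} {succ t} e
        u-correct : Correct u
        u-correct = ih is (∈-respʳ (succ t) (time s) s≈ (self-∈-succ t)) m
        l≡ : toℕ l ≡ line (C t)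
        l≡ = proj₁ (active⇒∈θ u l u-correct p)
        t∈θ : t ∈ θ
        t∈θ = proj₂ (active⇒∈θ u l u-correct p)
        succ∈ : succ t ∈ succ θ
        succ∈ = succ-∈-succ t θ oθ t∈θ
        det : l′ ≡ line (C (succ t)) × regs s ≋ registers (C (succ t))
        det = Execute-deterministic y x (lookup P l)
          -- Justified snapshots have their registers in γ, and below γ the two oracles agree.
          (λ i → agree (regs u i) (proj₁ (coherent is m) i))
          exec
          (Execute-resp x (lookup P l) (≋-sym (proj₂ u-correct ∘ suc)) (λ i → ≈-refl _)
            (Step⇒Execute P x (C t) (C (succ t)) l l≡ (step {t} t∈θ)))

      limit-correct : ∀ s → Earlier s → AtLimit F B s → Correct s
      limit-correct s ih (tr , lim , cond) = m , λ j → ⊆-antisym (s (suc j)) (contents (C t) j)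
          (λ z → from (∈-liminf-contents t m lim j)
            (let a , h = proj₁ (cond j) z in a , λ r q →
             let is , e , c , z∈ = h r q
             in ∈-respʳ (el B (is (suc j))) (contents (C (el t r)) j) (matches r is e c j) z∈))
          -- An element of the inferior limit lies in all contents from some time `el t a` on, hence
          -- in the snapshot that the condition provides at `el t a`; a later omission is excluded.
          (λ z → let a , h = to (∈-liminf-contents t m lim j) (el-∈ (contents (C t) j) z)
                     is , e , c , h′ = proj₂ (cond j) a
                     z′ , e′ = ∈-respʳ (contents (C (el t a)) j) (el B (is (suc j)))
                                (≈-sym (matches a is e c j)) (h a (el-∈ (el t a)))
                 in ∈-respˡ (s (suc j)) (≈-sym e′)
                      (Sum.[ id , (λ (r , q , js , e″ , c′ , n) → ⊥-elim (n
                        (∈-respˡ (el B (js (suc j))) e′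
                          (∈-respʳ (contents (C (el t r)) j) (el B (js (suc j)))
                            (≈-sym (matches r js e″ c′ j)) (h r q))))) ]′ (h′ z′)))
        where
        t : V
        t = time s

        correct : ∀ a is → time (el B ∘ is) ≈ el t a → code (el B ∘ is) ∈ F →
          Correct (el B ∘ is)
        correct a is e c = ih is (a , e) c

        matches : ∀ a is → time (el B ∘ is) ≈ el t a → code (el B ∘ is) ∈ F →
          Matches (el t a) (el B ∘ is)
        matches a is e c =
          let m′ , h = correct a is e c
          in λ j → ≈-trans (h j) (contents-cong (time (el B ∘ is)) (el t a) m′ e j)

        ∈θ⁺ : ∀ a → el t a ∈ succ θ
        -- Any component would do: the condition is only used to find a snapshot at time `el t a`.
        ∈θ⁺ a = let is , e , c , _ = proj₂ (cond zero) a
                in ∈-respˡ (succ θ) e (proj₁ (correct a is e c))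

        ∈θ : ∀ a → el t a ∈ θ
        ∈θ a with ∈-succ⁻ θ (∈θ⁺ a)
        ... | inj₁ n = n
        -- Were θ among the earlier times, its successor would be too, since t is a limit, and would
        -- have to be at most θ.
        ... | inj₂ e =
          let b , e′ = proj₂ lim a
          in ⊥-elim (∈-irrefl (succ θ) (∈-respˡ (succ θ)
               (≈-trans {el t b} {succ (el t a)} {succ θ}
                 (≈-sym {succ (el t a)} {el t b} e′) (succ-cong (el t a) θ e))
               (∈θ⁺ b)))

        m : t ∈ succ θ
        -- A recorded time is not assumed to be an ordinal; transitivity from `AtLimit`, together
        -- with elements below θ, makes it one.
        m = ⊆⇒∈-succ t θ (tr , λ a → proj₁ (Ordinal-∈ (el t a) θ oθ (∈θ a))) oθ ∈θ

      -- Induction on time, as structural recursion on a set t that merely represents it: the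
      -- recorded times of earlier snapshots are only `≈` to subterms of t.
      correct : ∀ t (is : Fin (3 ℕ.+ k) → Index B) → time (el B ∘ is) ≈ t →
        code (el B ∘ is) ∈ F → Correct (el B ∘ is)
      correct t@(sup A f) is e m = Sum.[ start-correct s ,
          Sum.[ step-correct s ih , limit-correct s ih ]′ ]′ (proj₂ (coherent is m))
        where
        s : Snapshot
        s = el B ∘ is
        ih : Earlier s
        ih js n m′ = let a , q = ∈-respʳ (time s) t e n in correct (f a) js q m′

      -- Before θ the run still takes a step, so its line is a line of P. The accepting snapshot
      -- must therefore have time θ.
      accepts⇒output : Accepts F B → registers (C θ) zero ≈ one
      accepts⇒output (is , m , h , o) with correct (time (el B ∘ is)) is (≈-refl _) m
      ... | m′ , h′ with ∈-succ⁻ θ m′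
      ...   | inj₂ e = ≈-trans {registers (C θ) zero} {regs (el B ∘ is) zero} {one}
          (≈-sym (≈-trans (h′ (suc zero)) (contents-cong (time (el B ∘ is)) θ m′ e (suc zero)))) o
      ...   | inj₁ m″ with step {time (el B ∘ is)} m″
      ...     | active , _ = ⊥-elim (h (fromℕ< active)
          (≈-trans (h′ zero) (≈-reflexive (cong fromℕ (sym (toℕ-fromℕ< active))))))

    -- Its time is zero, a successor or a limit, and matching snapshots at all earlier times supply
    -- the witnesses for the corresponding clause.
    justified : ∀ F B s → time s ∈ succ θ → Matches (time s) s →
      (∀ a → SnapshotAt F B (el (time s) a) (Matches (el (time s) a))) →
      Justified F B x α ξ s
    justified F B s m h prev =
      (λ i → ∈-respˡ α (≈-sym (h (suc i))) (below {t} m i)) ,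
      Sum.map start (Sum.map next limit)
        (zero-succ-limit t (Ordinal-∈ t (succ θ) (Ordinal-succ θ oθ) m))
      where
      t : V
      t = time s

      start : t ≈ ∅ → Start ξ s
      start e = e ,
        ≈-trans (h zero) (≈-reflexive (cong fromℕ
          (trans (line-cong {t} {∅} m e) start-line))) ,
        λ i → ≈-trans (h (suc i)) (≈-trans (registers-cong {t} {∅} m e i)
                (start-registers i))

      next : (∃[ a ] t ≈ succ (el t a)) → AfterStep F B x s
      next (a , e) with prev a
      ... | is , e′ , c , h′ =
        is ,
        ≈-trans {t} {succ r} {succ (time (el B ∘ is))} e (succ-cong r _ (≈-sym e′)) ,
        c , l , line (C (succ r)) ,
        ≈-trans (h′ zero) (≈-reflexive (cong fromℕ (sym l≡))) ,
        ≈-trans (h zero) (contents-cong t (succ r) m e zero) ,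
        Execute-resp x (lookup P l) (≋-sym (h′ ∘ suc))
          (λ i → ≈-sym (≈-trans (h (suc i)) (contents-cong t (succ r) m e (suc i))))
          (Step⇒Execute P x (C r) (C (succ r)) l l≡ st)
        where
        r : V
        r = el t a
        r∈θ : r ∈ θ
        r∈θ = ∈-⊆ t θ (el-∈ t a) (Sum.[ ∈⇒⊆ t θ (proj₁ oθ) , ≈⇒⊆ t θ ]′ (∈-succ⁻ θ m))
        st : Step P x (C r) (C (succ r))
        st = step {r} r∈θ
        l : Fin (length P)
        l = fromℕ< (proj₁ st)
        l≡ : toℕ l ≡ line (C r)
        l≡ = toℕ-fromℕ< (proj₁ st)

      limit : Limit t → AtLimit F B s
      limit lim =
        proj₁ (Ordinal-∈ t (succ θ) (Ordinal-succ θ oθ) m) , lim , λ j →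
        (λ z → let a , h′ = to (∈-liminf-contents t m lim j)
                              (∈-respʳ (s (suc j)) (contents (C t) j) (h j) (el-∈ (s (suc j)) z))
               in a , λ r q → let is , e , c , k = prev r in is , e , c ,
                  ∈-respʳ (contents (C (el t r)) j) (el B (is (suc j))) (≈-sym (k j)) (h′ r q)) ,
        (λ a → let is , e , c , k = prev a in is , e , c , λ z → kept j a (el (el B (is (suc j))) z))
        where
        kept : ∀ j a z → z ∈ s (suc j) ⊎ OmittedAfter F B t a j z
        kept j a z with em {z ∈ s (suc j)}
        ... | yes z∈ = inj₁ z∈
        ... | no z∉ with em {OmittedAfter F B t a j z}
        ...   | yes o = inj₂ o
        -- If z is never omitted from time `el t a` on, it belongs to the inferior limit.
        ...   | no n = ⊥-elim (z∉ (∈-respʳ (contents (C t) j) (s (suc j)) (≈-sym (h j))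
            (from (∈-liminf-contents t m lim j) (a , λ r q → dne λ z∉r → n
              (let is , e , c , k = prev r in r , q , is , e , c ,
               λ z∈ → z∉r (∈-respʳ (el B (is (suc j))) (contents (C (el t r)) j) (k j) z∈))))))

    -- Completeness: a halting run has a constructible description

    module Completeness (B : V) (times : ∀ t → t ∈ succ θ → t ∈ B)
                        (values : ∀ t → t ∈ succ θ → ∀ j → contents (C t) j ∈ B)
                        (cB : Constructible B) (cx : Constructible x)
                        (cα : Constructible α) (cξ : Constructible ξ) where

      Recorded : V → V → Set
      Recorded t G = Coherent G B x α ξ × SnapshotAt G B t (Matches t)

      snapshot : ∀ t → t ∈ succ θ → Fin (3 ℕ.+ k) → Index B
      snapshot t m zero    = proj₁ (times t m)
      snapshot t m (suc j) = proj₁ (values t m j)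

      snapshot-time : ∀ t m → el B (snapshot t m zero) ≈ t
      snapshot-time t m = ≈-sym (proj₂ (times t m))

      snapshot-matches : ∀ t m → Matches t (el B ∘ snapshot t m)
      snapshot-matches t m j = ≈-sym (proj₂ (values t m j))

      -- The family of sets given by `ih` need not be definable in L. But all of them are elements
      -- of one `L γ`, and the union of all coherent elements of `L γ` is definable, includes each
      -- of them and is coherent. The code of the snapshot at t is then added.
      extend : ∀ t → t ∈ succ θ →
        (∀ i → Σ[ G ∈ V ] Constructible G × Recorded (el t i) G) →
        Σ[ G ∈ V ] Constructible G × Recorded t G
      extend t m ih =
        F ,
        (succ (succ γ) , Ordinal-succ (succ γ) (Ordinal-succ γ oγ) , ∈-Def-L (succ γ) F∈Def) ,
        coherent ,
        is , snapshot-time t m , c∈F , snapshot-matches t m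
        where
        is : Fin (3 ℕ.+ k) → Index B
        is = snapshot t m

        c : V
        c = code (el B ∘ is)

        parameters : Vector V 5
        parameters = c ∷ B ∷ x ∷ α ∷ ξ ∷ []

        sets : Index t ⊎ Fin 5 → V
        sets (inj₁ i) = proj₁ (ih i)
        sets (inj₂ i) = parameters i

        sets-constructible : ∀ i → Constructible (sets i)
        sets-constructible (inj₁ i) = proj₁ (proj₂ (ih i))
        sets-constructible (inj₂ zero) = code-constructible (el B ∘ is) λ i →
          let δ , oδ , B∈ = cB in δ , oδ , ∈-trans B (L δ) (L-transitive δ) (el-∈ B (is i)) B∈
        sets-constructible (inj₂ (suc zero))                   = cB
        sets-constructible (inj₂ (suc (suc zero)))             = cx
        sets-constructible (inj₂ (suc (suc (suc zero))))       = cα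
        sets-constructible (inj₂ (suc (suc (suc (suc zero))))) = cξ

        bound : Σ[ γ ∈ V ] Ordinal γ × (∀ i → sets i ∈ L γ)
        bound = constructible-bound sets sets-constructible

        γ : V
        γ = proj₁ bound

        oγ : Ordinal γ
        oγ = proj₁ (proj₂ bound)

        -- One level above γ, so that `L γ`, the bound of the quantifier over coherent sets, is
        -- available as a parameter.
        M : V
        M = L (succ γ)

        Q : Vector V 6 × V → Set
        Q (e , z) =
          (∃[ g ] Coherent (el (e zero) g) (e (suc (suc zero))) (e (suc (suc (suc zero))))
                    (e (suc (suc (suc (suc zero))))) (e (suc (suc (suc (suc (suc zero)))))) ×
                  z ∈ el (e zero) g) ⊎
          z ≈ e (suc zero)

        F : V
        F = separate M λ i → Q ((L γ ∷ parameters) , el M i)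

        v : ∀ i → Var (id {A = Vector V 6}) (λ e → e i)
        v i = var i λ _ → refl

        F∈Def : F ∈ Def M
        F∈Def = separate-∈ {v = id} {P = Q}
          (∃∈ᵈ (wk (v zero))
             (Coherentᵈ P em new (wk (wk (v (suc (suc zero))))) (wk (wk (v (suc (suc (suc zero))))))
                (wk (wk (v (suc (suc (suc (suc zero)))))))
                (wk (wk (v (suc (suc (suc (suc (suc zero)))))))) ∧ᵈ
              wk new ∈ᵈ new) ∨ᵈ
           new ≈ᵈ wk (v (suc zero)))
          M (L-transitive (succ γ)) (L γ ∷ parameters)
          λ { zero → L-∈-L γ ; (suc i) → ∈-L-succ γ (proj₂ (proj₂ bound) (inj₂ i)) }

        c∈F : c ∈ F
        c∈F = let i , e = ∈-L-succ γ (proj₂ (proj₂ bound) (inj₂ zero))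
              in (i , inj₂ (≈-sym e)) , e

        coherent⇒⊆F : ∀ g → Coherent (el (L γ) g) B x α ξ → el (L γ) g ⊆ F
        coherent⇒⊆F g h j =
          let i , e = ∈-L-succ γ (L-transitive γ g j)
          in (i , inj₁ (g , h , ∈-respˡ (el (L γ) g) e (el-∈ (el (L γ) g) j))) , e

        earlier : ∀ i → SnapshotAt F B (el t i) (Matches (el t i))
        earlier i =
          let G , _ , h , s = ih i
              g , e = proj₂ (proj₂ bound) (inj₁ i)
              G′⊆G : el (L γ) g ⊆ G
              G′⊆G = ≈⇒⊆ (el (L γ) g) G (≈-sym e)
          in SnapshotAt-map G F B (el t i) {Matches (el t i)} {Matches (el t i)}
               (⊆-trans G (el (L γ) g) F (≈⇒⊆ G (el (L γ) g) e)
                 (coherent⇒⊆F g λ js m′ →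
                   Justified-mono G (el (L γ) g) B x α ξ (el B ∘ js) (≈⇒⊆ G (el (L γ) g) e)
                     (h js (∈-⊆ (el (L γ) g) G m′ G′⊆G))))
               (λ _ h′ → h′) s

        coherent : Coherent F B x α ξ
        -- An old snapshot is justified within the coherent set it comes from.
        coherent js ((i , inj₁ (g , h , n)) , e) =
          Justified-mono (el (L γ) g) F B x α ξ (el B ∘ js) (coherent⇒⊆F g h)
            (h js (∈-respˡ (el (L γ) g) (≈-sym e) n))
        -- The tuple `js` is only known to have the same code as the new snapshot; injectivity of
        -- `code` identifies their components.
        coherent js ((i , inj₂ e′) , e) = justified F B (el B ∘ js) m′
          (λ j → ≈-trans (s≈ (suc j)) (≈-trans (snapshot-matches t m j)
                   (contents-cong t (el B (js zero)) m t≈ j)))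
          (λ a → let i , a≈ = ≈⇒⊆ (el B (js zero)) t (≈-sym t≈) a
                     ls , p , q , h = earlier i
                 in ls , ≈-trans p (≈-sym a≈) , q , λ j → ≈-trans (h j)
                      (contents-cong (el t i) (el (el B (js zero)) a)
                        (∈-trans t (succ θ) (proj₁ (Ordinal-succ θ oθ)) (el-∈ t i) m) (≈-sym a≈) j))
          where
          s≈ : (el B ∘ js) ≋ (el B ∘ is)
          s≈ = code-injective (el B ∘ js) (el B ∘ is) (≈-trans e e′)
          t≈ : t ≈ el B (js zero)
          t≈ = ≈-sym (≈-trans (s≈ zero) (snapshot-time t m))
          m′ : el B (js zero) ∈ succ θ
          m′ = ∈-respˡ (succ θ) t≈ m

      record-run : ∀ t → t ∈ succ θ → Σ[ G ∈ V ] Constructible G × Recorded t G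
      record-run t@(sup A f) m = extend t m λ a →
        record-run (f a) (∈-trans t (succ θ) (proj₁ (Ordinal-succ θ oθ)) (el-∈ t a) m)

      accepting-run : Ordinal α → x ⊆ α → registers (C θ) zero ≈ one →
        Σ[ F ∈ V ] Constructible F × AcceptingRun F B x α ξ
      accepting-run oα x⊆α o with record-run θ (self-∈-succ θ)
      ... | F , cF , h , is , e , m , match = F , cF , oα , x⊆α , h , is , m ,
        (λ l l≈ → <⇒≱ (toℕ<n l) (subst (length P ℕ.≤_)
          (fromℕ-injective _ _ (≈-trans (≈-sym (match zero)) l≈)) halted)) ,
        ≈-trans {regs (el B ∘ is) zero} {registers (C θ) zero} {one} (match (suc zero)) o

    constructible-accepting-run : Ordinal α → x ⊆ α → Constructible x → ξ ∈ α →
      registers (C θ) zero ≈ one →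
      Σ[ F ∈ V ] Σ[ B ∈ V ] Constructible F × Constructible B × AcceptingRun F B x α ξ
    constructible-accepting-run oα x⊆α cx ξ∈α o =
      let F , cF , h = accepting-run oα x⊆α o in F , L η , cF , cL , h
      where
      -- All possible components of snapshots: times up to θ, line numbers, and register contents,
      -- which lie in α. Taking B to be a level of L above them makes it constructible.
      ordinals : Index (succ θ) ⊎ ℕ ⊎ Index α → V
      ordinals (inj₁ t)        = el (succ θ) t
      ordinals (inj₂ (inj₁ l)) = fromℕ l
      ordinals (inj₂ (inj₂ i)) = el α i

      ordinals-ordinal : ∀ i → Ordinal (ordinals i)
      ordinals-ordinal (inj₁ t) =
        Ordinal-∈ (el (succ θ) t) (succ θ) (Ordinal-succ θ oθ) (el-∈ (succ θ) t)
      ordinals-ordinal (inj₂ (inj₁ l)) = Ordinal-fromℕ l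
      ordinals-ordinal (inj₂ (inj₂ i)) = Ordinal-∈ (el α i) α oα (el-∈ α i)

      bound : Σ[ η ∈ V ] Ordinal η × (∀ i → ordinals i ∈ L η)
      bound = constructible-bound ordinals
        λ i → Ordinal-constructible (ordinals i) (ordinals-ordinal i)

      η : V
      η = proj₁ bound

      cL : Constructible (L η)
      cL = succ η , Ordinal-succ η (proj₁ (proj₂ bound)) , L-∈-L η

      times : ∀ t → t ∈ succ θ → t ∈ L η
      times t (i , e) = ∈-respˡ (L η) (≈-sym e) (proj₂ (proj₂ bound) (inj₁ i))

      values : ∀ t → t ∈ succ θ → ∀ j → contents (C t) j ∈ L η
      values t m zero    = proj₂ (proj₂ bound) (inj₂ (inj₁ (line (C t))))
      values t m (suc j) =
        let i , e = below {t} m j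
        in ∈-respˡ (L η) (≈-sym e) (proj₂ (proj₂ bound) (inj₂ (inj₂ i)))

      open Completeness (L η) times values
        cL cx (Ordinal-constructible α oα)
        (Ordinal-constructible ξ (Ordinal-∈ ξ α oα ξ∈α))

-- Reflection to `L α` and the contradiction

reflect : ∀ α (oα : Ordinal α) → Σ₁-Elementary α oα →
  {Q : Vector V 5 → Set} → Definable id Q → ∀ ξ → ξ ∈ L α →
  ∀ F B y γ → Constructible F → Constructible B → Constructible y → Constructible γ →
  Q (F ∷ B ∷ y ∷ γ ∷ ξ ∷ []) →
  ∃[ F′ ] ∃[ B′ ] ∃[ y′ ] ∃[ γ′ ]
    Q (el (L α) F′ ∷ el (L α) B′ ∷ el (L α) y′ ∷ el (L α) γ′ ∷ ξ ∷ [])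
reflect α oα elementary (definable d c) ξ (ξ′ , ξ≈) F B y γ cF cB cy cγ h =
  -- The outermost quantifier binds the last of the four sets, so witnesses appear in the reverse of
  -- the order in Q. The matrix is moved from V to L and from `L α` back to V by absoluteness.
  let γ′ , y′ , B′ , F′ , s = from (elementary (ex (ex (ex (ex (bounded d))))) (ξ′ ∷ []))
        ((γ , cγ) , (y , cy) , (B , cB) , (F , cF) ,
         from (Δ₀-absolute proj₁
                (λ (x , γ , o , m) i → (el x i , γ , o ,
                   ∈-trans x (L γ) (L-transitive γ) (el-∈ x i) m) , ≈-refl (el x i))
                d _ (F ∷ B ∷ y ∷ γ ∷ ξ ∷ [])
                λ { zero → ≈-refl F ; (suc zero) → ≈-refl B ; (suc (suc zero)) → ≈-refl y
                  ; (suc (suc (suc zero))) → ≈-refl γ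
                  ; (suc (suc (suc (suc zero)))) → ≈-sym ξ≈ })
              (from (c (F ∷ B ∷ y ∷ γ ∷ ξ ∷ [])) h))
  in F′ , B′ , y′ , γ′ ,
     to (c (el (L α) F′ ∷ el (L α) B′ ∷ el (L α) y′ ∷ el (L α) γ′ ∷ ξ ∷ []))
        (to (Δ₀-absolute (el (L α))
              (λ i j → let k , e = L-transitive α i j in k , ≈-sym e)
              d _ (el (L α) F′ ∷ el (L α) B′ ∷ el (L α) y′ ∷ el (L α) γ′ ∷ ξ ∷ [])
              λ { zero → ≈-refl _ ; (suc zero) → ≈-refl _ ; (suc (suc zero)) → ≈-refl _
                ; (suc (suc (suc zero))) → ≈-refl _
                ; (suc (suc (suc (suc zero)))) → ≈-sym ξ≈ })
            s)

module _ (em : ExcludedMiddle 0ℓ) (α : V) (oα : Ordinal α) where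
  open Classical em
  open OrdinalsInL em

  -- The oracles y and y ∪ {γ} agree below γ, so the run described by F
  -- accepts both of them.
  accepting-run⇒¬recognizes : ∀ {k} (P : Program (suc k)) ξ x →
    (∀ z → z ⊆ α → Constructible z → ¬ z ≈ x → Computes {0} {k} α P z (ξ ∷ []) ∅) →
    ∀ F B y γ → ¬ Snapshots.AcceptingRun P F B (el (L α) y) (el (L α) γ) ξ
  accepting-run⇒¬recognizes P ξ x rejects F B y γ (oδ , y⊆δ , coherent , accepts) =
    δ∉y (∈-respʳ x Y (≈-sym y≈x) (∈-respʳ z x z≈x δ∈z))
    where
    Y Δ : V
    Y = el (L α) y
    Δ = el (L α) γ

    δ∈α : Δ ∈ α
    δ∈α = Ordinal-∈-L α Δ oα oδ (el-∈ (L α) γ)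

    -- For z other than x there is a halting run with output 0, while soundness of F for that very
    -- run gives output 1.
    accepted : ∀ z → z ⊆ α → Constructible z → (∀ w → w ∈ Δ → w ∈ Y ⇔ w ∈ z) → z ≈ x
    accepted z z⊆α cz agree = dne λ z≉x →
      let θ , C , oθ , run , halted , out = rejects z z⊆α cz z≉x
          open HaltingRun em P α z ξ θ C oθ run halted
          open Soundness F B Y Δ coherent agree
      in succ≉∅ ∅ (≈-trans {one} {registers (C θ) zero} {∅}
           (≈-sym {registers (C θ) zero} {one} (accepts⇒output accepts)) out)

    z : V
    z = separate (L α) λ i → el (L α) i ∈ Y ⊎ el (L α) i ≈ Δ

    δ∉y : Δ ∉ Y
    δ∉y m = ∈-irrefl Δ (∈-⊆ Y Δ m y⊆δ)

    y⊆α : Y ⊆ α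
    y⊆α = ⊆-trans Y Δ α y⊆δ (∈⇒⊆ Δ α (proj₁ oα) δ∈α)

    y≈x : Y ≈ x
    y≈x = accepted Y y⊆α (α , oα , el-∈ (L α) y) λ w _ → mk⇔ id id

    δ∈z : Δ ∈ z
    δ∈z = (γ , inj₂ (≈-refl Δ)) , ≈-refl Δ

    z≈x : z ≈ x
    z≈x = accepted z
      (λ (i , h) → Sum.[ (λ m → ∈-⊆ Y α m y⊆α) , (λ e → ∈-respˡ α (≈-sym e) δ∈α) ]′ h)
      (succ α , Ordinal-succ α oα , ∈-Def-L α
        (separate-∈ {v = λ (y , δ) → y ∷ δ ∷ []}
          (new ∈ᵈ wk (var zero λ _ → refl) ∨ᵈ new ≈ᵈ wk (var (suc zero) λ _ → refl))
          (L α) (L-transitive α) (Y , Δ)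
          λ { zero → el-∈ (L α) y ; (suc zero) → el-∈ (L α) γ }))
      λ w w∈δ → mk⇔
        (λ m → let i , e = ∈-trans Y (L α) (L-transitive α) m (el-∈ (L α) y)
               in (i , inj₁ (∈-respˡ Y e m)) , e)
        (λ { ((i , inj₁ m) , e) → ∈-respˡ Y (≈-sym e) m
           ; ((i , inj₂ e′) , e) → ⊥-elim (∈-irrefl Δ (∈-respˡ Δ (≈-trans e e′) w∈δ)) })

  ¬Recognizable : Σ₁-Elementary α oα →
    ∀ x → x ⊆ α → Constructible x → ¬ Recognizable α x
  ¬Recognizable elementary x x⊆α cx (k , P , ξ , ξ∈α , recognizes) =
    let θ , C , oθ , run , halted , out = proj₁ (recognizes x x⊆α cx) (≈-refl x)
        F , B , cF , cB , h = HaltingRun.constructible-accepting-run em P α x ξ θ C oθ run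
                                halted oα x⊆α cx ξ∈α out
        F′ , B′ , y , γ , h′ = reflect α oα elementary
          {λ e → Snapshots.AcceptingRun P (e zero) (e (suc zero)) (e (suc (suc zero)))
                   (e (suc (suc (suc zero)))) (e (suc (suc (suc (suc zero)))))}
          (AcceptingRunᵈ P em (v zero) (v (suc zero)) (v (suc (suc zero)))
            (v (suc (suc (suc zero)))) (v (suc (suc (suc (suc zero))))))
          ξ (∈-⊆ α (L α) ξ∈α (Ordinal-⊆-L α oα))
          F B x α cF cB cx (Ordinal-constructible α oα) h
    in accepting-run⇒¬recognizes P ξ x (λ z z⊆α cz → proj₂ (recognizes z z⊆α cz))
         (el (L α) F′) (el (L α) B′) y γ h′
    where
    v : ∀ i → Var (id {A = Vector V 5}) (λ e → e i)
    v i = var i λ _ → refl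

lemma16 : (∀ {ℓ} → ExcludedMiddle ℓ) →
    (α : V) → (Σ[ β ∈ V ] Ordinal β × IsSigma β α) →
    ¬ (Σ[ x ∈ V ] x ⊆ α × Constructible x × Recognizable α x) ×
    ¬ (Σ[ x ∈ V ] x ⊆ α × Constructible x × LostMelody α x)
lemma16 em α (_ , _ , oα , _ , elementary , _) =
  (λ (x , x⊆α , cx , r) → none x x⊆α cx r) ,
  (λ (x , x⊆α , cx , r , _) → none x x⊆α cx r)
  where
  none : ∀ x → x ⊆ α → Constructible x → ¬ Recognizable α x
  none = ¬Recognizable em α oα elementary
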